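{- Let $G$ be a finite, connected, simple undirected graph with vertices $v_0,\dots,v_n$ and edge set $E$. Label the regions of the $G$-semiorder arrangement by the following procedure: label the central region (the set of $x$ with $|x_i-x_j|<1$ for all $\{v_i,v_j\}\in E$) by $-1_V=-\sum_{k}v_k$ and put it in a queue; while the queue is nonempty, remove its first region $r$, and for each unlabeled region $r'$ bordering $r$, determine the unique indices $i\neq j$ such that $|x_i-x_j|<1$ on $r$ but $x_j>x_i+1$ on $r'$, label $r'$ by $\lambda(r)+v_j$, where $\lambda(r)$ is the label of $r$, and add $r'$ to the end of the queue. Let $\lambda(r)$ denote the resulting label of each region $r$. Then $\lambda=\psi\circ\tau$, where $\tau(r)$ is the partial orientation $\{(v_i,v_j):\{v_i,v_j\}\in E,\ x_j>x_i+1\text{ on }r\}$ and $\psi(\mathcal{O})=\sum_{v}(\mathrm{indeg}_{\mathcal{O}}(v)-1)v$. Consequently $\lambda$ is a surjection from the set of regions onto the set $\mathcal{S}$ of quasi-superstable divisors on $G$, and for every $\sigma\in\mathfrak{S}$ we have $\lambda\circ\rho\circ\eta_\sigma=\mathrm{id}_{\mathcal{S}}$, where $\eta_\sigma:\mathcal{S}\to\mathbb{O}$ is injective.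
   Context: The $G$-semiorder arrangement is the set of hyperplanes $x_i-x_j=1$ in $\mathbb{R}^{n+1}$ for all ordered pairs $i\neq j$ with $\{v_i,v_j\}\in E$; its regions are the connected components of the complement of their union. Divisors are elements of $\mathbb{Z}V$, $V=\{v_0,\dots,v_n\}$. Partial orientation: $\mathcal{O}\subseteq V\times V$ with $(u,v)\in\mathcal{O}\Rightarrow\{u,v\}\in E$, $(v,u)\notin\mathcal{O}$; non-oriented edges are blank; $\mathrm{indeg}_{\mathcal{O}}(v)=|\{u:(u,v)\in\mathcal{O}\}|$. A potential cycle is a cycle of $G$ whose blank edges can be directed to make it directed; $\mathbb{O}$ is the set of $G$-semiorientations (partial orientations whose potential cycles all have more blank than oriented edges). $\rho:\mathbb{O}\to\{\text{regions}\}$ sends $\mathcal{O}$ to the set of $x$ with $x_j>x_i+1$ for $(v_i,v_j)\in\mathcal{O}$ and $|x_i-x_j|<1$ for blank edges $\{v_i,v_j\}$; it is a bijection with inverse $\tau$. Sandpiles: for a graph $H$ with sink $s$, a configuration $c\ge0$ on nonsink vertices is superstable if no nonempty set $X$ of nonsink vertices has $c-\widetilde{\Delta}1_X\ge0$, with $\widetilde{\Delta}$ the Laplacian $D-A$ with the sink row/column deleted. $K(G)$ is $G$ plus a sink $\tilde q$ adjacent to every vertex of $V$. $\mathcal{S}$ is the set of $c\in\mathbb{Z}V$ with $c+1_V$ superstable on $K(G)$. $\mathfrak{S}$ is the symmetric group on $\{0,\dots,n\}$ ($\sigma$ identified with the ordering $v_{\sigma(0)},\dots,v_{\sigma(n)}$),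 and $\eta_\sigma(c)$ is the partial orientation produced by the following algorithm. A vertex $v\in V$ is unstable in a configuration $b$ on $K(G)$ if $b_v\ge\deg_{K(G)}(v)$; firing $v$ subtracts $\deg_{K(G)}(v)$ from $b_v$ and adds $1$ to each $G$-neighbor. Start with $b=\sum_v(\deg_{K(G)}(v)-1)v-c$, $\mathcal{O}=\emptyset$, and a queue consisting of the unstable vertices in order $\sigma$. While the queue is nonempty, remove its first vertex $w_0$ and fire it (each vertex is fired at most once); append the not-yet-fired vertices that just became unstable, in order $\sigma$; for each edge $\{w_0,v\}$ not yet oriented or marked blank, mark it blank if $v$ was unstable before this firing, and otherwise add $(w_0,v)$ to $\mathcal{O}$. Then $\eta_\sigma(c)=\mathcal{O}$.
   Formalization: The regions of the G-semiorder arrangement are represented by points with rational coordinates instead of real ones; every region is open and so contains rational points. -}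

module Defs where

open import Data.Nat as ℕ using (ℕ; zero; suc)
open import Data.Integer as ℤ using (ℤ; +_)
open import Data.Rational as ℚ using (ℚ; 0ℚ; 1ℚ)
import Data.Rational.Properties as ℚP
open import Data.Fin using (Fin; _≟_)
open import Data.Fin.Permutation using (Permutation′; _⟨$⟩ʳ_)
open import Data.Bool using (Bool; true; false; _∧_; _∨_; not; if_then_else_)
open import Data.List using (List; []; _∷_; _++_; [_]; filterᵇ; map; length; zip; allFin; foldr)
open import Data.List.Relation.Unary.Any using (Any)
open import Data.List.Relation.Unary.All using (All)
open import Data.List.Relation.Unary.AllPairs using (AllPairs)
open import Data.Maybe using (Maybe; just; nothing)
open import Data.Product using (Σ; ∃; _×_; _,_; proj₁; proj₂)
open import Relation.Nullary using (¬_; does)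
open import Relation.Binary.PropositionalEquality using (_≡_; _≢_)
open import Relation.Binary.Construct.Closure.ReflexiveTransitive using (Star)

-- Graphs: finite simple undirected graphs on vertex set Fin m
-- (vertex v_i is i : Fin m, m = n+1).

record Graph (m : ℕ) : Set where
  field
    E      : Fin m → Fin m → Bool
    sym    : ∀ i j → E i j ≡ E j i
    irrefl : ∀ i → E i i ≡ false
open Graph public

Edge : ∀ {m} → Graph m → Fin m → Fin m → Set
Edge G i j = E G i j ≡ true

data Path {m} (G : Graph m) : Fin m → Fin m → Set where
  here : ∀ {u} → Path G u u
  step : ∀ {u w v} → Edge G u w → Path G w v → Path G u v

Connected : ∀ {m} → Graph m → Set
Connected {m} G = ∀ (u v : Fin m) → Path G u v

_==_ : ∀ {m} → Fin m → Fin m → Bool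
i == j = does (i ≟ j)

count : ∀ {m} → (Fin m → Bool) → ℕ
count {m} p = length (filterᵇ (λ i → (p i)) (allFin m))

degG : ∀ {m} → Graph m → Fin m → ℕ
degG G v = count (λ u → E G v u)

-- degree in K(G) (G plus a sink adjacent to every vertex)
degK : ∀ {m} → Graph m → Fin m → ℕ
degK G v = suc (degG G v)

Div : ℕ → Set
Div m = Fin m → ℤ

_≗D_ : ∀ {m} → Div m → Div m → Set
d ≗D e = ∀ k → d k ≡ e k

addV : ∀ {m} → Div m → Fin m → Div m
addV d j k = d k ℤ.+ (if k == j then + 1 else + 0)

minusOneV : ∀ {m} → Div m
minusOneV _ = ℤ.- (+ 1)

lapInd : ∀ {m} → Graph m → (Fin m → Bool) → Div m
lapInd G X v =
  (if X v then + degK G v else + 0) ℤ.- + count (λ u → X u ∧ E G u v)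

Superstable : ∀ {m} → Graph m → Div m → Set
Superstable {m} G c =
  (∀ v → + 0 ℤ.≤ c v) ×
  (∀ (X : Fin m → Bool) → (∃ λ v → X v ≡ true) →
     ¬ (∀ v → + 0 ℤ.≤ c v ℤ.- lapInd G X v))

InS : ∀ {m} → Graph m → Div m → Set
InS G c = Superstable G (λ v → c v ℤ.+ + 1)

-- Partial orientations: O i j ≡ true means (v_i , v_j) ∈ 𝒪.

POr : ℕ → Set
POr m = Fin m → Fin m → Bool

IsPartialOrientation : ∀ {m} → Graph m → POr m → Set
IsPartialOrientation G O =
  ∀ i j → O i j ≡ true → Edge G i j × O j i ≡ false

indeg : ∀ {m} → POr m → Fin m → ℕ
indeg O v = count (λ u → O u v)

ψ : ∀ {m} → POr m → Div m
ψ O v = + indeg O v ℤ.- + 1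

cycPairs : ∀ {A : Set} → List A → List (A × A)
cycPairs []       = []
cycPairs (w ∷ ws) = zip (w ∷ ws) (ws ++ [ w ])

IsCycle : ∀ {m} → Graph m → List (Fin m) → Set
IsCycle G ws =
  (3 ℕ.≤ length ws) × AllPairs _≢_ ws ×
  All (λ p → Edge G (proj₁ p) (proj₂ p)) (cycPairs ws)

-- potential cycle in this traversal direction: no oriented edge points
-- against the direction (so blanks can be directed to make it directed)
IsPotentialDir : ∀ {m} → POr m → List (Fin m) → Set
IsPotentialDir O ws = All (λ p → O (proj₂ p) (proj₁ p) ≡ false) (cycPairs ws)

numOriented : ∀ {m} → POr m → List (Fin m) → ℕ
numOriented O ws = length (filterᵇ (λ p → (O (proj₁ p) (proj₂ p) ∨ O (proj₂ p) (proj₁ p))) (cycPairs ws))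

numBlank : ∀ {m} → POr m → List (Fin m) → ℕ
numBlank O ws = length (filterᵇ (λ p → not (O (proj₁ p) (proj₂ p) ∨ O (proj₂ p) (proj₁ p))) (cycPairs ws))

IsSemiorientation : ∀ {m} → Graph m → POr m → Set
IsSemiorientation G O =
  IsPartialOrientation G O ×
  (∀ ws → IsCycle G ws → IsPotentialDir O ws → numOriented O ws ℕ.< numBlank O ws)

Point : ℕ → Set
Point m = Fin m → ℚ

Above : ∀ {m} → Point m → Fin m → Fin m → Set
Above x i j = x i ℚ.+ 1ℚ ℚ.< x j

Generic : ∀ {m} → Graph m → Point m → Set
Generic G x = ∀ i j → Edge G i j → x i ℚ.+ 1ℚ ≢ x j

SameRegion : ∀ {m} → Graph m → Point m → Point m → Set
SameRegion G x y = ∀ i j → Edge G i j → (Above x i j → Above y i j) × (Above y i j → Above x i j)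

Differ : ∀ {m} → Graph m → Point m → Point m → Fin m → Fin m → Set
Differ G x y i j = Edge G i j × ¬ ((Above x i j → Above y i j) × (Above y i j → Above x i j))

Bordering : ∀ {m} → Graph m → Point m → Point m → Set
Bordering G x y = ∃ λ i → ∃ λ j → Differ G x y i j ×
  (∀ k l → Differ G x y k l → k ≡ i × l ≡ j)

Blank : ∀ {m} → Point m → Fin m → Fin m → Set
Blank x i j = (x i ℚ.< x j ℚ.+ 1ℚ) × (x j ℚ.< x i ℚ.+ 1ℚ)

τ : ∀ {m} → Graph m → Point m → POr m
τ G x i j = E G i j ∧ does (x i ℚ.+ 1ℚ ℚP.<? x j)

InRho : ∀ {m} → Graph m → POr m → Point m → Set
InRho G O x = ∀ i j → Edge G i j →
  (O i j ≡ true → Above x i j) × (O i j ≡ false → O j i ≡ false → Blank x i j)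

-- The labelling procedure (breadth-first search over regions),
-- modelled as a nondeterministic transition system; regions are
-- represented by generic points, up to SameRegion.

Labelling : ℕ → Set
Labelling m = List (Point m × Div m)

HasLabel : ∀ {m} → Graph m → Labelling m → Point m → Div m → Set
HasLabel G L x d = Any (λ e → SameRegion G (proj₁ e) x × (proj₂ e ≗D d)) L

Labelled : ∀ {m} → Graph m → Labelling m → Point m → Set
Labelled G L x = Any (λ e → SameRegion G (proj₁ e) x) L

IsLabel : ∀ {m} → Graph m → Labelling m → Point m → Div m → Set
IsLabel G L x d = HasLabel G L x d × (∀ e → HasLabel G L x e → e ≗D d)

record BFSState (m : ℕ) : Set where
  constructor ⟨_,_,_⟩
  field
    current : Maybe (Point m)
    queue   : List (Point m)
    labels  : Labelling m

data BFSStep {m} (G : Graph m) : BFSState m → BFSState m → Set where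
  pop : ∀ r q L → BFSStep G ⟨ nothing , r ∷ q , L ⟩ ⟨ just r , q , L ⟩
  visit : ∀ r q L d r' i j →
    Any (λ e → SameRegion G (proj₁ e) r × proj₂ e ≡ d) L →
    Generic G r' → Bordering G r r' → ¬ Labelled G L r' →
    Edge G i j → Blank r i j → Above r' i j →
    BFSStep G ⟨ just r , q , L ⟩ ⟨ just r , q ++ [ r' ] , L ++ [ (r' , addV d j) ] ⟩
  finish : ∀ r q L →
    (∀ r' → Generic G r' → Bordering G r r' → Labelled G L r') →
    BFSStep G ⟨ just r , q , L ⟩ ⟨ nothing , q , L ⟩

-- the central region is represented by the origin
origin : ∀ {m} → Point m
origin _ = 0ℚ

bfsInit : ∀ {m} → BFSState m
bfsInit = ⟨ nothing , [ origin ] , [ (origin , minusOneV) ] ⟩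

BFSResult : ∀ {m} → Graph m → Labelling m → Set
BFSResult G L = Star (BFSStep G) bfsInit ⟨ nothing , [] , L ⟩

order : ∀ {m} → Permutation′ m → List (Fin m)
order {m} σ = map (σ ⟨$⟩ʳ_) (allFin m)

record EState (m : ℕ) : Set where
  constructor est
  field
    chips : Fin m → ℤ
    fired : Fin m → Bool
    ori   : POr m
    blank : Fin m → Fin m → Bool
    q     : List (Fin m)

unstable : ∀ {m} → Graph m → (Fin m → ℤ) → Fin m → Bool
unstable G b v = (+ degK G v) ℤ.≤ᵇ b v

fire : ∀ {m} → Graph m → Fin m → (Fin m → ℤ) → (Fin m → ℤ)
fire G w b v =
  if v == w then b v ℤ.- + degK G w
  else (if E G w v then b v ℤ.+ + 1 else b v)

etaStep : ∀ {m} → Graph m → Permutation′ m → EState m → EState m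
etaStep G σ (est b f O B [])      = est b f O B []
etaStep G σ (est b f O B (w ∷ q)) = est b' f' O' B' (q ++ new)
  where
    b' = fire G w b
    f' = λ v → f v ∨ (v == w)
    new = filterᵇ (λ v → (not (f' v) ∧ unstable G b' v ∧ not (unstable G b v))) (order σ)
    free = λ v → E G w v ∧ not (O w v ∨ O v w ∨ B w v)
    O' = λ i j → O i j ∨ ((i == w) ∧ free j ∧ not (unstable G b j))
    markB = λ v → free v ∧ unstable G b v
    B' = λ i j → B i j ∨ ((i == w) ∧ markB j) ∨ ((j == w) ∧ markB i)

iter : ∀ {A : Set} → ℕ → (A → A) → A → A
iter zero    f a = a
iter (suc k) f a = iter k f (f a)

η : ∀ {m} → Graph m → Permutation′ m → Div m → POr m
η {m} G σ c = EState.ori (iter m (etaStep G σ) s0)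
  where
    b0 = λ v → (+ degK G v ℤ.- + 1) ℤ.- c v
    s0 = est b0 (λ _ → false) (λ _ _ → false) (λ _ _ → false)
             (filterᵇ (λ v → (unstable G b0 v)) (order σ))

{-# OPTIONS --safe #-}
module Submission where

-- A region is determined by its pattern of arrows τ, and crossing one hyperplane changes τ by one arrow;
-- an added arrow (i , j) raises ψ ∘ τ at j by 1.  Every noncentral region borders one with an arrow less,
-- so the search proceeds by the number of arrows and reaches everything, and λ = ψ ∘ τ.  Conversely, a
-- vertex entering the queue of the algorithm for η can be given a height just above that of the vertex
-- being fired plus 1, but below that of the next queued vertex plus 1.  With these heights the resulting
-- orientation is τ of a point, and the in-degree of v counts the neighbours whose firing was needed to
-- make v unstable, which is c v + 1.

open import Defs renaming (sym to E-sym)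
open import Data.Nat as ℕ using (ℕ; zero; suc)
import Data.Nat.Properties as ℕP
open import Data.Integer as ℤ using (ℤ; +_)
import Data.Integer.Properties as ℤP
import Data.Integer.Tactic.RingSolver as ℤSolver
open import Data.Rational as ℚ using (ℚ; 0ℚ; 1ℚ)
import Data.Rational.Properties as ℚP
open import Data.Rational.Solver using (module +-*-Solver)
open import Data.Fin using (Fin; zero; suc; _≟_; combine; remQuot)
import Data.Fin.Properties as FinP
open import Data.Fin.Permutation
  using (Permutation′; _⟨$⟩ʳ_; _⟨$⟩ˡ_; inverseˡ; inverseʳ) renaming (id to id-permutation)
open import Data.Bool as Bool using (Bool; true; false; _∧_; _∨_; not; if_then_else_; T?)
open import Data.Bool.Properties using (T-≡; ∧-zeroʳ)
open import Data.List
  using (List; []; _∷_; _++_; [_]; filterᵇ; map; length; zip; allFin; cartesianProduct; cartesianProductWith)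
open import Data.List.Properties using (map-tabulate; ++-assoc; ++-identityʳ)
open import Data.List.Membership.Propositional using (_∈_; _∉_; find; lose)
open import Data.List.Membership.Propositional.Properties
  using (∈-map⁺; ∈-map⁻; ∈-allFin; ∈-++⁺ˡ; ∈-++⁺ʳ; ∈-++⁻; ∈-filter⁺; ∈-filter⁻;
         ∈-cartesianProduct⁺; ∈-cartesianProductWith⁺; ∈-cartesianProductWith⁻)
open import Data.List.Relation.Unary.Any as Any using (Any; here; there; any?)
import Data.List.Relation.Unary.Any.Properties as AnyP
open import Data.List.Relation.Unary.All as All using (All; []; _∷_)
import Data.List.Relation.Unary.All.Properties as AllP
open import Data.List.Relation.Unary.AllPairs as AllPairs using (AllPairs; []; _∷_)
import Data.List.Relation.Unary.AllPairs.Properties as AllPairsP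
open import Data.List.Relation.Unary.Unique.Propositional using (Unique)
import Data.List.Relation.Unary.Unique.Propositional.Properties as UniqueP
open import Data.Maybe using (just; nothing)
open import Data.Product using (∃; _×_; _,_; proj₁; proj₂; uncurry)
open import Data.Sum using (_⊎_; inj₁; inj₂)
open import Data.Empty using (⊥-elim)
open import Function using (_∘_; id; Equivalence)
open import Relation.Binary.Construct.Closure.ReflexiveTransitive using (Star; _◅_; _◅◅_)
  renaming (ε to stay)
open import Relation.Binary.Definitions using (Tri; tri<; tri≈; tri>)
open import Relation.Nullary using (Dec; ¬_; yes; no; contradiction; does)
open import Relation.Nullary.Decidable using (dec-true; dec-false; from-yes; map′; _×-dec_)
open import Relation.Binary.PropositionalEquality
  using (_≡_; _≢_; refl; sym; trans; cong; cong₂; subst; subst₂; module ≡-Reasoning)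

-- That a label cannot depend on the order of visits is the easy half: `ψ ∘ τ` is constant on
-- regions and every run respects it. The existence of a complete run is a separate matter. A
-- `visit` only adds an arrow, while `finish` requires all bordering regions, those with an arrow
-- less included, to be labelled; so the queue discipline has to show that a layer is complete
-- before the next one is opened. Each step must also know whether a region lies across a given
-- hyperplane. This asks whether a finite system of strict difference constraints has a rational
-- solution, and elimination of variables decides it. The descent cannot simply shrink a point,
-- because several arrows may become tight together; a second direction breaks the tie in favour of
-- one of them. For `η` the difficulty is that heights are fixed before later firings are known. It
-- is met by keeping the queue sorted and inside a window of length less than 1, above everything
-- fired, so that a new vertex is placed once and never moved.

bool-cases : ∀ b → b ≡ true ⊎ b ≡ false
bool-cases true  = inj₁ refl
bool-cases false = inj₂ refl

true≢false : ∀ {b} → b ≡ true → b ≢ false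
true≢false refl ()

≢true⇒≡false : ∀ {b} → b ≢ true → b ≡ false
≢true⇒≡false {true}  h = contradiction refl h
≢true⇒≡false {false} h = refl

bool-ext : ∀ {a b} → (a ≡ true → b ≡ true) → (b ≡ true → a ≡ true) → a ≡ b
bool-ext {true}  {b}     f g = sym (f refl)
bool-ext {false} {false} f g = refl
bool-ext {false} {true}  f g = g refl

∧-true : ∀ {a b} → a ∧ b ≡ true → a ≡ true × b ≡ true
∧-true {true} {true} _ = refl , refl

true-∧ : ∀ {a b} → a ≡ true → b ≡ true → a ∧ b ≡ true
true-∧ refl refl = refl

-- Counting, minima and rational inequalities.

[_]₁ : Bool → ℕ
[ true ]₁  = 1
[ false ]₁ = 0

length-filterᵇ-map : ∀ {A B : Set} (p : B → Bool) (f : A → B) xs →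
  length (filterᵇ p (map f xs)) ≡ length (filterᵇ (p ∘ f) xs)
length-filterᵇ-map p f []       = refl
length-filterᵇ-map p f (x ∷ xs) with p (f x)
... | true  = cong suc (length-filterᵇ-map p f xs)
... | false = length-filterᵇ-map p f xs

count-suc : ∀ {m} (p : Fin (suc m) → Bool) → count p ≡ [ p zero ]₁ ℕ.+ count (p ∘ suc)
count-suc {m} p with p zero
... | true  = cong suc (trans (cong (length ∘ filterᵇ p) (sym (map-tabulate id suc)))
                              (length-filterᵇ-map p suc (allFin m)))
... | false = trans (cong (length ∘ filterᵇ p) (sym (map-tabulate id suc)))
                    (length-filterᵇ-map p suc (allFin m))

count-cong : ∀ {m} {p q : Fin m → Bool} → (∀ i → p i ≡ q i) → count p ≡ count q
count-cong {zero}          e = refl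
count-cong {suc m} {p} {q} e = begin
  count p                              ≡⟨ count-suc p ⟩
  [ p zero ]₁ ℕ.+ count (p ∘ suc)      ≡⟨ cong₂ (λ b k → [ b ]₁ ℕ.+ k) (e zero) (count-cong (e ∘ suc)) ⟩
  [ q zero ]₁ ℕ.+ count (q ∘ suc)      ≡⟨ count-suc q ⟨
  count q                              ∎
  where open ≡-Reasoning

-- In-degrees, numbers of arrows, fired vertices and fired neighbours all change by flipping one
-- Boolean, so each of those increments is an instance of this lemma.
count-flip : ∀ {m} {p q : Fin m → Bool} j → p j ≡ false → q j ≡ true →
  (∀ k → k ≢ j → p k ≡ q k) → count q ≡ suc (count p)
count-flip {suc m} {p} {q} zero pj qj e
  rewrite count-suc p | count-suc q | pj | qj =
  cong suc (count-cong (λ i → sym (e (suc i) (λ ()))))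
count-flip {suc m} {p} {q} (suc j) pj qj e
  rewrite count-suc p | count-suc q | e zero (λ ()) =
  trans (cong ([ q zero ]₁ ℕ.+_)
          (count-flip j pj qj (λ k k≢j → e (suc k) (λ { refl → k≢j refl }))))
        (ℕP.+-suc [ q zero ]₁ _)

count-split : ∀ {m} (p q : Fin m → Bool) →
  count p ≡ count (λ i → q i ∧ p i) ℕ.+ count (λ i → not (q i) ∧ p i)
count-split {zero}  p q = refl
count-split {suc m} p q
  rewrite count-suc p | count-suc (λ i → q i ∧ p i) | count-suc (λ i → not (q i) ∧ p i)
        | count-split (p ∘ suc) (q ∘ suc)
  with q zero
... | true  = sym (ℕP.+-assoc [ p zero ]₁ _ _)
... | false = trans (sym (ℕP.+-assoc [ p zero ]₁ x y))
                    (trans (cong (ℕ._+ y) (ℕP.+-comm [ p zero ]₁ x)) (ℕP.+-assoc x [ p zero ]₁ y))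
  where
  x = count (λ i → q (suc i) ∧ p (suc i))
  y = count (λ i → not (q (suc i)) ∧ p (suc i))

count-mono : ∀ {m} {p q : Fin m → Bool} → (∀ i → p i ≡ true → q i ≡ true) → count p ℕ.≤ count q
count-mono {zero}          h = ℕ.z≤n
count-mono {suc m} {p} {q} h
  rewrite count-suc p | count-suc q = ℕP.+-mono-≤ (head (p zero) (q zero) (h zero)) (count-mono (h ∘ suc))
  where
  head : ∀ a b → (a ≡ true → b ≡ true) → [ a ]₁ ℕ.≤ [ b ]₁
  head false b    _ = ℕ.z≤n
  head true  b    k rewrite k refl = ℕP.≤-refl

count-false : ∀ {m} {p : Fin m → Bool} → (∀ i → p i ≡ false) → count p ≡ 0
count-false {zero}      h = refl
count-false {suc m} {p} h rewrite count-suc p | h zero = count-false (h ∘ suc)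

count-≤ : ∀ {m} (p : Fin m → Bool) → count p ℕ.≤ m
count-≤ {zero}  p = ℕ.z≤n
count-≤ {suc m} p rewrite count-suc p with p zero
... | true  = ℕ.s≤s (count-≤ (p ∘ suc))
... | false = ℕP.m≤n⇒m≤1+n (count-≤ (p ∘ suc))

count≡0⇒false : ∀ {m} (p : Fin m → Bool) → count p ≡ 0 → ∀ i → p i ≡ false
count≡0⇒false {suc m} p h i rewrite count-suc p with p zero in eq
count≡0⇒false {suc m} p h zero    | false = eq
count≡0⇒false {suc m} p h (suc i) | false = count≡0⇒false (p ∘ suc) h i

count-positive : ∀ {m} (p : Fin m → Bool) {k} → count p ≡ suc k → ∃ λ i → p i ≡ true
count-positive {suc m} p h rewrite count-suc p with p zero in eq
... | true  = zero , eq
... | false with count-positive (p ∘ suc) h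
...   | i , pi = suc i , pi

count-<-missing : ∀ {m} (p : Fin m → Bool) w → p w ≡ false → count p ℕ.< m
count-<-missing {suc m} p zero    h rewrite count-suc p | h = ℕ.s≤s (count-≤ (p ∘ suc))
count-<-missing {suc m} p (suc w) h rewrite count-suc p with p zero
... | true  = ℕ.s≤s (count-<-missing (p ∘ suc) w h)
... | false = ℕP.m≤n⇒m≤1+n (count-<-missing (p ∘ suc) w h)

-- Serves twice: for the lowest vertex of a set that might fire, and for the arrow of least height
-- difference.
argmin : ∀ {k} (X : Fin k → Bool) (f : Fin k → ℚ) → (∃ λ v → X v ≡ true) →
  ∃ λ v → X v ≡ true × (∀ u → X u ≡ true → f v ℚ.≤ f u)
argmin {suc k} X f (v₀ , h) with bool-cases (X zero) | ℕP._≟_ (count (X ∘ suc)) 0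
... | inj₂ ¬z | yes none = ⊥-elim (absent v₀ h)
  where
  absent : ∀ v → X v ≢ true
  absent zero    t = true≢false t ¬z
  absent (suc v) t = true≢false t (count≡0⇒false (X ∘ suc) none v)
... | inj₁ z | yes none = zero , z , least
  where
  least : ∀ u → X u ≡ true → f zero ℚ.≤ f u
  least zero    _ = ℚP.≤-refl
  least (suc u) t = ⊥-elim (true≢false t (count≡0⇒false (X ∘ suc) none u))
... | z? | no some with argmin (X ∘ suc) (f ∘ suc) (count-positive (X ∘ suc) (sym (ℕP.suc-pred _ {{ℕ.≢-nonZero some}})))
...   | v , Xv , v≤ with z?
...     | inj₂ ¬z = suc v , Xv , λ { zero t → ⊥-elim (true≢false t ¬z) ; (suc u) t → v≤ u t }
...     | inj₁ z with ℚP.≤-total (f zero) (f (suc v))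
...       | inj₁ le = zero , z , λ { zero t → ℚP.≤-refl ; (suc u) t → ℚP.≤-trans le (v≤ u t) }
...       | inj₂ ge = suc v , Xv , λ { zero t → ge ; (suc u) t → v≤ u t }

-- A strict inequality depends only on the difference of its sides, so every linear rearrangement
-- reduces to one ring identity.
<-shift : ∀ {r s p q} → s ℚ.- r ≡ q ℚ.- p → r ℚ.< s → p ℚ.< q
<-shift {r} {s} {p} {q} e r<s =
  subst₂ ℚ._<_ (eq₁ r p) (trans (cong (λ t → t ℚ.+ p) e) (eq₂ q p))
    (ℚP.+-monoˡ-< p (ℚP.+-monoˡ-< (ℚ.- r) r<s))
  where
  open +-*-Solver
  eq₁ : ∀ r p → (r ℚ.- r) ℚ.+ p ≡ p
  eq₁ = solve 2 (λ r p → (r :- r) :+ p := p) refl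
  eq₂ : ∀ q p → (q ℚ.- p) ℚ.+ p ≡ q
  eq₂ = solve 2 (λ q p → (q :- p) :+ p := q) refl

0<1 : 0ℚ ℚ.< 1ℚ
0<1 = ℚP.positive⁻¹ 1ℚ

p<p+1 : ∀ p → p ℚ.< p ℚ.+ 1ℚ
p<p+1 p = <-shift (solve 1 (λ p → con 1ℚ :- con 0ℚ := (p :+ con 1ℚ) :- p) refl p) 0<1
  where open +-*-Solver

+1-mono-< : ∀ {p q} → p ℚ.< q → p ℚ.+ 1ℚ ℚ.< q ℚ.+ 1ℚ
+1-mono-< = ℚP.+-monoˡ-< 1ℚ

-- Regions and their patterns of arrows

does-true : ∀ {P : Set} (P? : Dec P) → does P? ≡ true → P
does-true (yes p) _ = p

Above-asym : ∀ {m} (x : Point m) {i j} → Above x i j → ¬ Above x j i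
Above-asym x {i} {j} p q =
  ℚP.<-asym {x i} {x j} (ℚP.<-trans {x i} {x i ℚ.+ 1ℚ} (p<p+1 (x i)) p)
            (ℚP.<-trans {x j} {x j ℚ.+ 1ℚ} (p<p+1 (x j)) q)

τ-true : ∀ {m} (G : Graph m) (x : Point m) {i j} → Edge G i j → Above x i j → τ G x i j ≡ true
τ-true G x {i} {j} e p = true-∧ e (dec-true (x i ℚ.+ 1ℚ ℚP.<? x j) p)

τ-edge : ∀ {m} (G : Graph m) (x : Point m) {i j} → τ G x i j ≡ true → Edge G i j
τ-edge G x h = proj₁ (∧-true h)

τ-above : ∀ {m} (G : Graph m) (x : Point m) {i j} → τ G x i j ≡ true → Above x i j
τ-above G x {i} {j} h = does-true (x i ℚ.+ 1ℚ ℚP.<? x j) (proj₂ (∧-true {E G i j} h))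

τ-false : ∀ {m} (G : Graph m) (x : Point m) {i j} → ¬ Above x i j → τ G x i j ≡ false
τ-false G x ¬p = ≢true⇒≡false (λ h → ¬p (τ-above G x h))

τ-below : ∀ {m} (G : Graph m) (x : Point m) → Generic G x → ∀ {i j} → Edge G i j →
  τ G x i j ≡ false → x j ℚ.< x i ℚ.+ 1ℚ
τ-below G x gen {i} {j} e h with ℚP.<-cmp (x j) (x i ℚ.+ 1ℚ)
... | tri< p _ _ = p
... | tri≈ _ p _ = contradiction (sym p) (gen i j e)
... | tri> _ _ p = contradiction h (true≢false (τ-true G x e p))

_≗O_ : ∀ {m} → POr m → POr m → Set
O ≗O P = ∀ i j → O i j ≡ P i j

sameRegion⇒≗O : ∀ {m} (G : Graph m) {x y : Point m} → SameRegion G x y → τ G x ≗O τ G y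
sameRegion⇒≗O G {x} {y} s i j = bool-ext
  (λ h → τ-true G y (τ-edge G x h) (proj₁ (s i j (τ-edge G x h)) (τ-above G x h)))
  (λ h → τ-true G x (τ-edge G y h) (proj₂ (s i j (τ-edge G y h)) (τ-above G y h)))

≗O⇒sameRegion : ∀ {m} (G : Graph m) {x y : Point m} → τ G x ≗O τ G y → SameRegion G x y
≗O⇒sameRegion G {x} {y} s i j e =
  (λ p → τ-above G y (trans (sym (s i j)) (τ-true G x e p))) ,
  (λ p → τ-above G x (trans (s i j) (τ-true G y e p)))

sameRegion-refl : ∀ {m} (G : Graph m) {x : Point m} → SameRegion G x x
sameRegion-refl G i j e = id , id

sameRegion-trans : ∀ {m} (G : Graph m) {x y z : Point m} →
  SameRegion G x y → SameRegion G y z → SameRegion G x z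
sameRegion-trans G s t i j e =
  proj₁ (t i j e) ∘ proj₁ (s i j e) , proj₂ (s i j e) ∘ proj₂ (t i j e)

ψ-cong : ∀ {m} {O P : POr m} → O ≗O P → ψ O ≗D ψ P
ψ-cong s v = cong (λ k → + k ℤ.- + 1) (count-cong (λ u → s u v))

ψ+1 : ∀ {m} (O : POr m) v → ψ O v ℤ.+ + 1 ≡ + indeg O v
ψ+1 O v = identity (+ indeg O v)
  where
  identity : ∀ k → k ℤ.- + 1 ℤ.+ + 1 ≡ k
  identity = ℤSolver.solve-∀

-- The covering relation of arrow sets under inclusion. `Bordering` is symmetric; a cover also
-- records which of the two regions has the extra arrow.
record Cover {m} (O P : POr m) (i j : Fin m) : Set where
  field
    lower : O i j ≡ false
    upper : P i j ≡ true
    other : ∀ k l → ¬ (k ≡ i × l ≡ j) → O k l ≡ P k l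

ψ-cover : ∀ {m} {O P : POr m} {i j} → Cover O P i j → ψ P ≗D addV (ψ O) j
ψ-cover {O = O} {P} {i} {j} c v with v ≟ j
... | yes refl = trans (cong (λ k → + k ℤ.- + 1)
                         (count-flip i lower upper (λ k k≢i → other k v (k≢i ∘ proj₁))))
                       (identity (+ indeg O v))
  where
  open Cover c
  identity : ∀ k → (+ 1 ℤ.+ k) ℤ.- + 1 ≡ k ℤ.- + 1 ℤ.+ + 1
  identity = ℤSolver.solve-∀
... | no v≢j = trans (cong (λ k → + k ℤ.- + 1)
                       (sym (count-cong (λ u → Cover.other c u v (v≢j ∘ proj₂)))))
                     (sym (ℤP.+-identityʳ _))

-- Ordered pairs are coded as elements of `Fin (m * m)`, so that the lemmas about `count` apply to
-- sets of arrows.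
level : ∀ {m} → POr m → ℕ
level {m} O = count (λ k → uncurry O (remQuot {m} m k))

level-cong : ∀ {m} {O P : POr m} → O ≗O P → level O ≡ level P
level-cong {m} s = count-cong (λ k → uncurry s (remQuot {m} m k))

level-cover : ∀ {m} {O P : POr m} {i j} → Cover O P i j → level P ≡ suc (level O)
level-cover {m} {O} {P} {i} {j} c = count-flip (combine i j)
  (trans (cong (uncurry O) (FinP.remQuot-combine i j)) lower)
  (trans (cong (uncurry P) (FinP.remQuot-combine i j)) upper)
  (λ k k≢ → other _ _ (λ { (p , q) → k≢ (trans (sym (FinP.combine-remQuot {m} m k)) (cong₂ combine p q)) }))
  where open Cover c

level≡0 : ∀ {m} {O : POr m} → level O ≡ 0 → ∀ i j → O i j ≡ false
level≡0 {O = O} h i j =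
  trans (sym (cong (uncurry O) (FinP.remQuot-combine i j))) (count≡0⇒false (λ k → uncurry O (remQuot _ k)) h (combine i j))

differ-flip : ∀ {m} (G : Graph m) {x y : Point m} {i j} → Differ G x y i j → τ G x i j ≢ τ G y i j
differ-flip G {x} {y} (e , ¬iff) h = ¬iff
  ((λ p → τ-above G y (trans (sym h) (τ-true G x e p))) ,
   (λ p → τ-above G x (trans h (τ-true G y e p))))

flip-differ : ∀ {m} (G : Graph m) {x y : Point m} {i j} → τ G x i j ≢ τ G y i j → Differ G x y i j
flip-differ G {x} {y} {i} {j} h with bool-cases (E G i j)
... | inj₁ e = e , λ { (f , g) → h (bool-ext
  (λ t → τ-true G y e (f (τ-above G x t))) (λ t → τ-true G x e (g (τ-above G y t)))) }
... | inj₂ ¬e = ⊥-elim (h (trans (≢true⇒≡false (λ t → true≢false (τ-edge G x t) ¬e))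
                       (sym (≢true⇒≡false (λ t → true≢false (τ-edge G y t) ¬e)))))

agree-off : ∀ {m} (G : Graph m) {x y : Point m} {i j} →
  (∀ k l → Differ G x y k l → k ≡ i × l ≡ j) → ∀ k l → ¬ (k ≡ i × l ≡ j) → τ G x k l ≡ τ G y k l
agree-off G {x} {y} u k l h with τ G x k l Bool.≟ τ G y k l
... | yes p = p
... | no ¬p = ⊥-elim (h (u k l (flip-differ G {x} {y} ¬p)))

cover⇒bordering : ∀ {m} (G : Graph m) {x y : Point m} {i j} →
  Cover (τ G x) (τ G y) i j → Bordering G x y
cover⇒bordering G {x} {y} {i} {j} c = i , j ,
  flip-differ G {x} {y} (λ h → true≢false upper (trans (sym h) lower)) ,
  unique
  where
  open Cover c
  unique : ∀ k l → Differ G x y k l → k ≡ i × l ≡ j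
  unique k l d with k ≟ i | l ≟ j
  ... | yes p | yes q = p , q
  ... | no ¬p | _     = ⊥-elim (differ-flip G {x} {y} d (other k l (¬p ∘ proj₁)))
  ... | yes _ | no ¬q = ⊥-elim (differ-flip G {x} {y} d (other k l (¬q ∘ proj₂)))

bordering⇒cover : ∀ {m} (G : Graph m) {x y : Point m} → Bordering G x y →
  (∃ λ i → ∃ λ j → Cover (τ G x) (τ G y) i j) ⊎ (∃ λ i → ∃ λ j → Cover (τ G y) (τ G x) i j)
bordering⇒cover G {x} {y} (i , j , d , u) with bool-cases (τ G x i j) | bool-cases (τ G y i j)
... | inj₁ p | inj₁ q = ⊥-elim (differ-flip G {x} {y} d (trans p (sym q)))
... | inj₂ p | inj₂ q = ⊥-elim (differ-flip G {x} {y} d (trans p (sym q)))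
... | inj₂ p | inj₁ q = inj₁ (i , j , record { lower = p ; upper = q ; other = agree-off G {x} {y} u })
... | inj₁ p | inj₂ q = inj₂ (i , j , record { lower = q ; upper = p
      ; other = λ k l h → sym (agree-off G {x} {y} u k l h) })

bordering⇒cover-at : ∀ {m} (G : Graph m) {x y : Point m} {i j} → Bordering G x y →
  τ G x i j ≡ false → τ G y i j ≡ true → Cover (τ G x) (τ G y) i j
bordering⇒cover-at G {x} {y} {i} {j} (_ , _ , _ , u) f t
  with u i j (flip-differ G {x} {y} (λ h → true≢false t (trans (sym h) f)))
... | refl , refl = record { lower = f ; upper = t ; other = agree-off G {x} {y} u }

cover-respˡ : ∀ {m} {O O′ P : POr m} {i j} → O ≗O O′ → Cover O P i j → Cover O′ P i j
cover-respˡ s c = record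
  { lower = trans (sym (s _ _)) lower
  ; upper = upper
  ; other = λ k l h → trans (sym (s k l)) (other k l h)
  }
  where open Cover c

cover-respʳ : ∀ {m} {O P P′ : POr m} {i j} → P ≗O P′ → Cover O P i j → Cover O P′ i j
cover-respʳ s c = record
  { lower = lower
  ; upper = trans (sym (s _ _)) upper
  ; other = λ k l h → trans (other k l h) (s k l)
  }
  where open Cover c

-- Superstability of the divisors `ψ (τ x)`.

deg-split : ∀ {m} (G : Graph m) (X : Fin m → Bool) v →
  degG G v ≡ count (λ u → X u ∧ E G u v) ℕ.+ count (λ u → not (X u) ∧ E G u v)
deg-split G X v = trans (count-cong (λ u → E-sym G v u)) (count-split (λ u → E G u v) X)

-- Chips sent along edges inside `X` come back, so a vertex of `X` loses one chip per neighbour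
-- outside `X`. The `suc` is the edge to the sink.
lapInd-inside : ∀ {m} (G : Graph m) (X : Fin m → Bool) {v} → X v ≡ true →
  lapInd G X v ≡ + suc (count (λ u → not (X u) ∧ E G u v))
lapInd-inside G X {v} h rewrite h | deg-split G X v = identity (+ count (λ u → X u ∧ E G u v)) (+ count (λ u → not (X u) ∧ E G u v))
  where
  identity : ∀ a b → (+ 1 ℤ.+ (a ℤ.+ b)) ℤ.- a ≡ + 1 ℤ.+ b
  identity = ℤSolver.solve-∀

lapInd-outside : ∀ {m} (G : Graph m) (X : Fin m → Bool) {v} → X v ≡ false →
  lapInd G X v ≡ ℤ.- + count (λ u → X u ∧ E G u v)
lapInd-outside G X {v} h rewrite h = ℤP.+-identityˡ _

-- The lowest vertex of X receives no arrow from X, so it cannot afford to take part in firing X.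
ψτ∈S : ∀ {m} (G : Graph m) (x : Point m) → InS G (ψ (τ G x))
ψτ∈S G x = (λ v → subst (+ 0 ℤ.≤_) (sym (ψ+1 (τ G x) v)) (ℤ.+≤+ ℕ.z≤n)) , stable
  where
  stable : ∀ X → (∃ λ v → X v ≡ true) → ¬ (∀ v → + 0 ℤ.≤ (ψ (τ G x) v ℤ.+ + 1) ℤ.- lapInd G X v)
  stable X ne h with argmin X x ne
  ... | v , Xv , least = ℕP.<⇒≱ (ℕ.s≤s indeg≤) (ℤP.drop‿+≤+ (ℤP.0≤i-j⇒j≤i fired))
    where
    fired : + 0 ℤ.≤ + indeg (τ G x) v ℤ.- + suc (count (λ u → not (X u) ∧ E G u v))
    fired = subst₂ (λ a b → + 0 ℤ.≤ a ℤ.- b) (ψ+1 (τ G x) v) (lapInd-inside G X Xv) (h v)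
    indeg≤ : indeg (τ G x) v ℕ.≤ count (λ u → not (X u) ∧ E G u v)
    indeg≤ = count-mono outside
      where
      outside : ∀ u → τ G x u v ≡ true → not (X u) ∧ E G u v ≡ true
      outside u t with X u in Xu
      ... | false = τ-edge G x t
      ... | true  = ⊥-elim (ℚP.<-irrefl refl (ℚP.<-≤-trans {x u} (p<p+1 (x u))
                      (ℚP.≤-trans (ℚP.<⇒≤ (τ-above G x t)) (least u Xu))))

-- Orientations that are realised by points are semiorientations.

InRho⇒generic : ∀ {m} (G : Graph m) {O : POr m} {x : Point m} →
  IsPartialOrientation G O → InRho G O x → Generic G x
InRho⇒generic G {O} {x} po r i j e h with bool-cases (O i j)
... | inj₁ t = ℚP.<-irrefl h (proj₁ (r i j e) t)
... | inj₂ f with bool-cases (O j i)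
...   | inj₁ t  = ℚP.<-asym {x i} (subst (x i ℚ.<_) h (p<p+1 (x i)))
                    (ℚP.<-trans (p<p+1 (x j)) (proj₁ (r j i (trans (E-sym G j i) e)) t))
...   | inj₂ f′ = ℚP.<-irrefl (sym h) (proj₂ (proj₂ (r i j e) f f′))

InRho⇒τ : ∀ {m} (G : Graph m) {O : POr m} {x : Point m} →
  IsPartialOrientation G O → InRho G O x → O ≗O τ G x
InRho⇒τ G {O} {x} po r i j = bool-ext to from
  where
  to : O i j ≡ true → τ G x i j ≡ true
  to t = τ-true G x (proj₁ (po i j t)) (proj₁ (r i j (proj₁ (po i j t))) t)
  from : τ G x i j ≡ true → O i j ≡ true
  from t with bool-cases (O i j) | bool-cases (O j i)
  ... | inj₁ p | _      = p
  ... | inj₂ p | inj₁ q = ⊥-elim (Above-asym x {i} {j} (τ-above G x t)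
                            (proj₁ (r j i (proj₁ (po j i q))) q))
  ... | inj₂ p | inj₂ q = ⊥-elim (ℚP.<-asym {x i ℚ.+ 1ℚ} (τ-above G x t)
                            (proj₂ (proj₂ (r i j (τ-edge G x t)) p q)))

-- Defined by recursion so that it unfolds together with the filtered length when an edge is added
-- in front.
ι : ℕ → ℚ
ι zero    = 0ℚ
ι (suc n) = 1ℚ ℚ.+ ι n

ι-mono-≤ : ∀ {a b} → a ℕ.≤ b → ι a ℚ.≤ ι b
ι-mono-≤ {b = zero}  ℕ.z≤n     = ℚP.≤-refl
ι-mono-≤ {b = suc b} ℕ.z≤n     = ℚP.≤-trans (ι-mono-≤ {b = b} ℕ.z≤n)
  (subst (ℚ._≤ ι (suc b)) (ℚP.+-identityˡ (ι b)) (ℚP.+-monoˡ-≤ (ι b) (ℚP.<⇒≤ 0<1)))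
ι-mono-≤ (ℕ.s≤s h) = ℚP.+-monoʳ-≤ 1ℚ (ι-mono-≤ h)

module _ {m} (G : Graph m) {O : POr m} {x : Point m} (r : InRho G O x) where

  private
    oriented blank : List (Fin m × Fin m) → ℕ
    oriented ps = length (filterᵇ (λ p → O (proj₁ p) (proj₂ p) ∨ O (proj₂ p) (proj₁ p)) ps)
    blank    ps = length (filterᵇ (λ p → not (O (proj₁ p) (proj₂ p) ∨ O (proj₂ p) (proj₁ p))) ps)

    first-edge : ∀ {a b} c ps → Edge G a b → O b a ≡ false →
      x b ℚ.+ ι (oriented ps) ℚ.< c ℚ.+ ι (blank ps) →
      x a ℚ.+ ι (oriented ((a , b) ∷ ps)) ℚ.< c ℚ.+ ι (blank ((a , b) ∷ ps))
    first-edge {a} {b} c ps e f h with O a b in eq | O b a in eq′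
    ... | true  | false = <-shift (identity (x a) (x b) c (ι (oriented ps)) (ι (blank ps)))
                            (ℚP.+-mono-< (proj₁ (r a b e) eq) h)
      where
      open +-*-Solver
      identity : ∀ xa xb c o n → (xb ℚ.+ (c ℚ.+ n)) ℚ.- ((xa ℚ.+ 1ℚ) ℚ.+ (xb ℚ.+ o))
        ≡ (c ℚ.+ n) ℚ.- (xa ℚ.+ (1ℚ ℚ.+ o))
      identity = solve 5 (λ xa xb c o n → (xb :+ (c :+ n)) :- ((xa :+ con 1ℚ) :+ (xb :+ o))
        := (c :+ n) :- (xa :+ (con 1ℚ :+ o))) refl
    ... | false | false = <-shift (identity (x a) (x b) c (ι (oriented ps)) (ι (blank ps)))
                            (ℚP.+-mono-< (proj₁ (proj₂ (r a b e) eq eq′)) h)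
      where
      open +-*-Solver
      identity : ∀ xa xb c o n → ((xb ℚ.+ 1ℚ) ℚ.+ (c ℚ.+ n)) ℚ.- (xa ℚ.+ (xb ℚ.+ o))
        ≡ (c ℚ.+ (1ℚ ℚ.+ n)) ℚ.- (xa ℚ.+ o)
      identity = solve 5 (λ xa xb c o n → ((xb :+ con 1ℚ) :+ (c :+ n)) :- (xa :+ (xb :+ o))
        := (c :+ (con 1ℚ :+ n)) :- (xa :+ o)) refl

    single-edge : ∀ {a b} → Edge G a b → O b a ≡ false →
      x a ℚ.+ ι (oriented [ (a , b) ]) ℚ.< x b ℚ.+ ι (blank [ (a , b) ])
    single-edge {a} {b} e f with O a b in eq | O b a in eq′
    ... | true  | false = subst₂ ℚ._<_ refl (sym (ℚP.+-identityʳ (x b))) (proj₁ (r a b e) eq)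
    ... | false | false = subst₂ ℚ._<_ (sym (ℚP.+-identityʳ (x a))) refl (proj₁ (proj₂ (r a b e) eq eq′))

    -- Removing the first vertex of a closed walk does not leave a closed walk, so the end point `z`
    -- is independent of the start; the cycle is the case where `z` is `w`.
    walk : ∀ w ws z → All (uncurry (Edge G)) (zip (w ∷ ws) (ws ++ [ z ])) →
      All (λ p → O (proj₂ p) (proj₁ p) ≡ false) (zip (w ∷ ws) (ws ++ [ z ])) →
      x w ℚ.+ ι (oriented (zip (w ∷ ws) (ws ++ [ z ]))) ℚ.< x z ℚ.+ ι (blank (zip (w ∷ ws) (ws ++ [ z ])))
    walk w []        z (e ∷ []) (f ∷ []) = single-edge e f
    walk w (w′ ∷ ws) z (e ∷ es) (f ∷ fs) = first-edge (x z) _ e f (walk w′ ws z es fs)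

  -- Around a potential cycle the height rises by more than 1 on an oriented edge and by more than −1
  -- on a blank one, and the total rise is 0.
  InRho⇒semiorientation : IsPartialOrientation G O → IsSemiorientation G O
  InRho⇒semiorientation po = po , cycle
    where
    cycle : ∀ ws → IsCycle G ws → IsPotentialDir O ws → numOriented O ws ℕ.< numBlank O ws
    cycle (w ∷ ws) (_ , _ , es) fs = ℕP.≰⇒> λ le →
      ℚP.<-irrefl refl (ℚP.<-≤-trans (walk w ws w es fs) (ℚP.+-monoʳ-≤ (x w) (ι-mono-≤ le)))

-- Removing an arrow

-- Strict on both sides, so genericity is built in. Each ordered pair gives one difference
-- constraint, which suits both the perturbation and the elimination below.
Realises : ∀ {m} → Graph m → POr m → Point m → Set
Realises G P y = ∀ k l → Edge G k l →
  (P k l ≡ true → Above y k l) × (P k l ≡ false → y l ℚ.< y k ℚ.+ 1ℚ)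

realises⇒generic : ∀ {m} (G : Graph m) {P : POr m} {y : Point m} → Realises G P y → Generic G y
realises⇒generic G {P} {y} R k l e h with bool-cases (P k l)
... | inj₁ t = ℚP.<-irrefl h (proj₁ (R k l e) t)
... | inj₂ f = ℚP.<-irrefl (sym h) (proj₂ (R k l e) f)

realises⇒≗O : ∀ {m} (G : Graph m) {P : POr m} {y : Point m} →
  (∀ k l → P k l ≡ true → Edge G k l) → Realises G P y → P ≗O τ G y
realises⇒≗O G {P} {y} ⊆E R k l = bool-ext
  (λ t → τ-true G y (⊆E k l t) (proj₁ (R k l (⊆E k l t)) t)) from
  where
  from : τ G y k l ≡ true → P k l ≡ true
  from t with bool-cases (P k l)
  ... | inj₁ p = p
  ... | inj₂ p = ⊥-elim (ℚP.<-asym {y l} (proj₂ (R k l (τ-edge G y t)) p) (τ-above G y t))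

generic⇒realises : ∀ {m} (G : Graph m) {P : POr m} {x : Point m} →
  Generic G x → P ≗O τ G x → Realises G P x
generic⇒realises G {P} {x} gen s k l e =
  (λ t → τ-above G x (trans (sym (s k l)) t)) , (λ f → τ-below G x gen e (trans (sym (s k l)) f))

setPair : ∀ {m} → POr m → Fin m → Fin m → Bool → POr m
setPair O i j b k l = if (k == i) ∧ (l == j) then b else O k l

setPair-at : ∀ {m} (O : POr m) i j b → setPair O i j b i j ≡ b
setPair-at O i j b rewrite dec-true (i ≟ i) refl | dec-true (j ≟ j) refl = refl

setPair-off : ∀ {m} (O : POr m) i j b k l → ¬ (k ≡ i × l ≡ j) → setPair O i j b k l ≡ O k l
setPair-off O i j b k l h with k ≟ i | l ≟ j
... | yes p | yes q = ⊥-elim (h (p , q))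
... | yes _ | no _  = refl
... | no _  | _     = refl

cover-unset : ∀ {m} (O : POr m) i j → O i j ≡ true → Cover (setPair O i j false) O i j
cover-unset O i j t = record
  { lower = setPair-at O i j false ; upper = t ; other = setPair-off O i j false }

cover-set : ∀ {m} (O : POr m) i j → O i j ≡ false → Cover O (setPair O i j true) i j
cover-set O i j f = record
  { lower = f ; upper = setPair-at O i j true ; other = λ k l h → sym (setPair-off O i j true k l h) }

-- Perturbation by a small positive parameter.

Eventually : (ℚ → Set) → Set
Eventually P = ∃ λ δ → 0ℚ ℚ.< δ × (∀ ε → 0ℚ ℚ.< ε → ε ℚ.≤ δ → P ε)

eventually-map : ∀ {P Q : ℚ → Set} → (∀ ε → P ε → Q ε) → Eventually P → Eventually Q
eventually-map f (δ , δ>0 , h) = δ , δ>0 , λ ε p q → f ε (h ε p q)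

eventually-const : ∀ {P : ℚ → Set} → (∀ ε → P ε) → Eventually P
eventually-const h = 1ℚ , 0<1 , λ ε _ _ → h ε

eventually-× : ∀ {P Q : ℚ → Set} → Eventually P → Eventually Q → Eventually (λ ε → P ε × Q ε)
eventually-× (δ , δ>0 , h) (γ , γ>0 , k) with ℚP.≤-total δ γ
... | inj₁ le = δ , δ>0 , λ ε p q → h ε p q , k ε p (ℚP.≤-trans q le)
... | inj₂ ge = γ , γ>0 , λ ε p q → h ε p (ℚP.≤-trans q ge) , k ε p q

eventually-∀ : ∀ {n} {P : Fin n → ℚ → Set} → (∀ i → Eventually (P i)) → Eventually (λ ε → ∀ i → P i ε)
eventually-∀ {zero}  h = eventually-const (λ _ ())
eventually-∀ {suc n} h = eventually-map (λ { ε (p , q) zero → p ; ε (p , q) (suc i) → q i })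
  (eventually-× (h zero) (eventually-∀ (h ∘ suc)))

affine-< : ∀ {a b c d} → a ℚ.< c → Eventually (λ ε → a ℚ.+ ε ℚ.* b ℚ.< c ℚ.+ ε ℚ.* d)
affine-< {a} {b} {c} {d} a<c = δ , δ>0 , below
  where
  open +-*-Solver
  -- The summand 1 keeps `N` positive when `b` equals `d`, and makes the first inequality strict in
  -- `ε (b − d) < ε N ≤ δ N = c − a`.
  N = ℚ.∣ b ℚ.- d ∣ ℚ.+ 1ℚ
  0<N : 0ℚ ℚ.< N
  0<N = ℚP.≤-<-trans (ℚP.0≤∣p∣ (b ℚ.- d)) (p<p+1 _)
  instance
    N-pos : ℚ.Positive N
    N-pos = ℚ.positive 0<N
    N-nonZero : ℚ.NonZero N
    N-nonZero = ℚP.pos⇒nonZero N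
    1/N-pos : ℚ.Positive (ℚ.1/ N)
    1/N-pos = ℚP.1/pos⇒pos N
  0<c-a : 0ℚ ℚ.< c ℚ.- a
  0<c-a = <-shift (solve 2 (λ a c → c :- a := (c :- a) :- con 0ℚ) refl a c) a<c
  δ = (c ℚ.- a) ℚ.* ℚ.1/ N
  δ>0 : 0ℚ ℚ.< δ
  δ>0 = subst (ℚ._< δ) (ℚP.*-zeroˡ (ℚ.1/ N)) (ℚP.*-monoˡ-<-pos (ℚ.1/ N) 0<c-a)
  δN : δ ℚ.* N ≡ c ℚ.- a
  δN = trans (ℚP.*-assoc (c ℚ.- a) (ℚ.1/ N) N)
       (trans (cong ((c ℚ.- a) ℚ.*_) (ℚP.*-inverseˡ N)) (ℚP.*-identityʳ (c ℚ.- a)))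
  ≤∣∣ : ∀ p → p ℚ.≤ ℚ.∣ p ∣
  ≤∣∣ p with ℚP.≤-total 0ℚ p
  ... | inj₁ 0≤p = ℚP.≤-reflexive (sym (ℚP.0≤p⇒∣p∣≡p 0≤p))
  ... | inj₂ p≤0 = ℚP.≤-trans p≤0 (ℚP.0≤∣p∣ p)
  below : ∀ ε → 0ℚ ℚ.< ε → ε ℚ.≤ δ → a ℚ.+ ε ℚ.* b ℚ.< c ℚ.+ ε ℚ.* d
  below ε ε>0 ε≤δ = <-shift
    (solve 5 (λ a b c d ε → (c :- a) :- ε :* (b :- d) := (c :+ ε :* d) :- (a :+ ε :* b)) refl a b c d ε)
    (subst (ε ℚ.* (b ℚ.- d) ℚ.<_) δN
      (ℚP.<-≤-trans
        (ℚP.*-monoʳ-<-pos ε {{ℚ.positive ε>0}} (ℚP.≤-<-trans (≤∣∣ (b ℚ.- d)) (p<p+1 _)))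
        (ℚP.*-monoʳ-≤-nonNeg N {{ℚP.pos⇒nonNeg N}} ε≤δ)))

affine-≡ : ∀ {a b c d} → a ≡ c → b ℚ.< d → Eventually (λ ε → a ℚ.+ ε ℚ.* b ℚ.< c ℚ.+ ε ℚ.* d)
affine-≡ {a} refl b<d =
  1ℚ , 0<1 , λ ε ε>0 _ → ℚP.+-monoʳ-< a (ℚP.*-monoʳ-<-pos ε {{ℚ.positive ε>0}} b<d)

-- Moves `z` in the direction `u`. A strict inequality at `z` survives a small move; an equality is
-- decided by comparing `u`. There are finitely many pairs, so one `ε` serves them all.
perturb : ∀ {m} (G : Graph m) (P : POr m) (z u : Point m) →
  (∀ k l → Edge G k l → P k l ≡ true  → z k ℚ.+ 1ℚ ℚ.< z l ⊎ (z k ℚ.+ 1ℚ ≡ z l × u k ℚ.< u l)) →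
  (∀ k l → Edge G k l → P k l ≡ false → z l ℚ.< z k ℚ.+ 1ℚ ⊎ (z k ℚ.+ 1ℚ ≡ z l × u l ℚ.< u k)) →
  ∃ λ y → Realises G P y
perturb {m} G P z u up down = y ε , proj₂ (proj₂ realised) ε (proj₁ (proj₂ realised)) ℚP.≤-refl
  where
  y : ℚ → Point m
  y ε k = z k ℚ.+ ε ℚ.* u k
  y+1 : ∀ ε k → (z k ℚ.+ 1ℚ) ℚ.+ ε ℚ.* u k ≡ y ε k ℚ.+ 1ℚ
  y+1 ε k = solve 2 (λ a b → (a :+ con 1ℚ) :+ b := (a :+ b) :+ con 1ℚ) refl (z k) (ε ℚ.* u k)
    where open +-*-Solver
  above : ∀ {k l} → z k ℚ.+ 1ℚ ℚ.< z l ⊎ (z k ℚ.+ 1ℚ ≡ z l × u k ℚ.< u l) →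
    Eventually (λ ε → (z k ℚ.+ 1ℚ) ℚ.+ ε ℚ.* u k ℚ.< y ε l)
  above (inj₁ p)       = affine-< p
  above (inj₂ (p , q)) = affine-≡ p q
  below : ∀ {k l} → z l ℚ.< z k ℚ.+ 1ℚ ⊎ (z k ℚ.+ 1ℚ ≡ z l × u l ℚ.< u k) →
    Eventually (λ ε → y ε l ℚ.< (z k ℚ.+ 1ℚ) ℚ.+ ε ℚ.* u k)
  below (inj₁ p)       = affine-< p
  below (inj₂ (p , q)) = affine-≡ (sym p) q
  pair : ∀ k l → Eventually (λ ε → Edge G k l →
    (P k l ≡ true → Above (y ε) k l) × (P k l ≡ false → y ε l ℚ.< y ε k ℚ.+ 1ℚ))
  pair k l with bool-cases (E G k l) | bool-cases (P k l)
  ... | inj₂ ¬e | _      = eventually-const λ ε e → ⊥-elim (true≢false e ¬e)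
  ... | inj₁ e  | inj₁ t = eventually-map (λ ε p _ →
    (λ _ → subst (ℚ._< y ε l) (y+1 ε k) p) , (λ f → ⊥-elim (true≢false t f))) (above (up k l e t))
  ... | inj₁ e  | inj₂ f = eventually-map (λ ε p _ →
    (λ t → ⊥-elim (true≢false t f)) , (λ _ → subst (y ε l ℚ.<_) (y+1 ε k) p)) (below (down k l e f))
  realised : Eventually (λ ε → Realises G P (y ε))
  realised = eventually-∀ λ k → eventually-∀ λ l → pair k l
  ε = proj₁ realised

two three : ℚ
two   = 1ℚ ℚ.+ 1ℚ
three = two ℚ.+ 1ℚ

steps : Bool → Bool → ℚ
steps a b = (if a then two else 0ℚ) ℚ.- (if b then two else 0ℚ)

-- The difference reaches 4 only if `a` and `d` both hold, that is, for the chosen arrow; otherwise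
-- it is at most 2. Three lies strictly between and is the rate of dilation.
steps-bound : ∀ a b c d → a ∧ d ≡ false → steps a b ℚ.- steps c d ℚ.< three
steps-bound = bound
  where
  test : ∀ a b c d → Dec (steps a b ℚ.- steps c d ℚ.< three)
  test a b c d = (steps a b ℚ.- steps c d) ℚP.<? three
  bound : ∀ a b c d → a ∧ d ≡ false → steps a b ℚ.- steps c d ℚ.< three
  bound false false false false _ = from-yes (test false false false false)
  bound false false false true  _ = from-yes (test false false false true)
  bound false false true  false _ = from-yes (test false false true false)
  bound false false true  true  _ = from-yes (test false false true true)
  bound false true  false false _ = from-yes (test false true false false)
  bound false true  false true  _ = from-yes (test false true false true)
  bound false true  true  false _ = from-yes (test false true true false)
  bound false true  true  true  _ = from-yes (test false true true true)
  bound true  false false false _ = from-yes (test true false false false)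
  bound true  false true  false _ = from-yes (test true false true false)
  bound true  true  false false _ = from-yes (test true true false false)
  bound true  true  true  false _ = from-yes (test true true true false)

steps-steep : three ℚ.< steps true false ℚ.- steps false true
steps-steep = from-yes (three ℚP.<? (steps true false ℚ.- steps false true))

inverse : ∀ d → 1ℚ ℚ.< d → ∃ λ r → 0ℚ ℚ.< r × r ℚ.< 1ℚ × d ℚ.* r ≡ 1ℚ
inverse d 1<d = r , ℚP.positive⁻¹ r , r<1 , dr≡1
  where
  instance
    d-pos : ℚ.Positive d
    d-pos = ℚ.positive (ℚP.<-trans 0<1 1<d)
    d-nonZero : ℚ.NonZero d
    d-nonZero = ℚP.pos⇒nonZero d
  r = ℚ.1/ d
  instance
    r-pos : ℚ.Positive r
    r-pos = ℚP.1/pos⇒pos d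
  dr≡1 : d ℚ.* r ≡ 1ℚ
  dr≡1 = ℚP.*-inverseʳ d
  r<1 : r ℚ.< 1ℚ
  r<1 = subst₂ ℚ._<_ (ℚP.*-identityˡ r) dr≡1 (ℚP.*-monoˡ-<-pos r 1<d)

-- Every region other than the central one borders a region with one arrow less: take an arrow (i , j)
-- of minimal height difference d.  In z = x / d that arrow has height exactly 1 and every other arrow
-- height at least 1; the dilation by 1 + 3ε lifts all of them above 1, while the tilt lowers the
-- difference by 4ε for (i , j) and by at most 2ε for every other pair.
module Descent {m} (G : Graph m) (x : Point m) (gen : Generic G x)
  (i j : Fin m) (ij : τ G x i j ≡ true)
  (least : ∀ k l → τ G x k l ≡ true → x j ℚ.- x i ℚ.≤ x l ℚ.- x k) where

  open +-*-Solver

  1<d : 1ℚ ℚ.< x j ℚ.- x i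
  1<d = <-shift (solve 2 (λ a b → b :- (a :+ con 1ℚ) := (b :- a) :- con 1ℚ) refl (x i) (x j))
          (τ-above G x ij)

  target : POr m
  target = setPair (τ G x) i j false

  target-⊆E : ∀ k l → target k l ≡ true → Edge G k l
  target-⊆E k l t with k ≟ i | l ≟ j
  ... | yes _ | no _  = τ-edge G x t
  ... | no _  | _     = τ-edge G x t

  i≢j : i ≢ j
  i≢j refl = Above-asym x (τ-above G x ij) (τ-above G x ij)

  lowered : (∃ λ r → 0ℚ ℚ.< r × r ℚ.< 1ℚ × (x j ℚ.- x i) ℚ.* r ≡ 1ℚ) → ∃ λ y → Realises G target y
  lowered (r , 0<r , r<1 , dr≡1) = perturb G target z u up down
    where
    z tilt u : Point m
    z k    = x k ℚ.* r
    tilt k = steps (k == i) (k == j)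
    u k    = three ℚ.* z k ℚ.+ tilt k

    z-diff : ∀ k l → (x l ℚ.- x k) ℚ.* r ≡ z l ℚ.- z k
    z-diff k l = solve 3 (λ a b r → (b :- a) :* r := b :* r :- a :* r) refl (x k) (x l) r

    z-ij : z i ℚ.+ 1ℚ ≡ z j
    z-ij = trans (cong (z i ℚ.+_) (trans (sym dr≡1) (z-diff i j)))
      (solve 2 (λ a b → a :+ (b :- a) := b) refl (z i) (z j))

    not-both : ∀ {k l} → ¬ (k ≡ i × l ≡ j) → (k == i) ∧ (l == j) ≡ false
    not-both {k} {l} ne with k ≟ i | l ≟ j
    ... | yes p | yes q = ⊥-elim (ne (p , q))
    ... | yes _ | no _  = refl
    ... | no _  | _     = refl

    -- On a tie `w` exceeds `z k` by exactly 1, so the dilation contributes exactly three and only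
    -- the difference of tilts has to be compared with it.
    u-rise : ∀ {k l} w s t → w ≡ z k ℚ.+ 1ℚ → s ℚ.- t ℚ.< three → three ℚ.* z k ℚ.+ s ℚ.< three ℚ.* w ℚ.+ t
    u-rise {k} w s t refl = <-shift
      (solve 4 (λ c a s t → c :- (s :- t) := (c :* (a :+ con 1ℚ) :+ t) :- (c :* a :+ s)) refl three (z k) s t)

    u-fall : ∀ {k} w s t → w ≡ z k ℚ.+ 1ℚ → three ℚ.< s ℚ.- t → three ℚ.* w ℚ.+ t ℚ.< three ℚ.* z k ℚ.+ s
    u-fall {k} w s t refl = <-shift
      (solve 4 (λ c a s t → (s :- t) :- c := (c :* a :+ s) :- (c :* (a :+ con 1ℚ) :+ t)) refl three (z k) s t)

    arrow : ∀ {k l} → τ G x k l ≡ true → ¬ (k ≡ i × l ≡ j) →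
      z k ℚ.+ 1ℚ ℚ.< z l ⊎ (z k ℚ.+ 1ℚ ≡ z l × u k ℚ.< u l)
    arrow {k} {l} t ne = split (ℚP.<-cmp (z k ℚ.+ 1ℚ) (z l))
      where
      split : Tri (z k ℚ.+ 1ℚ ℚ.< z l) (z k ℚ.+ 1ℚ ≡ z l) (z l ℚ.< z k ℚ.+ 1ℚ) →
        z k ℚ.+ 1ℚ ℚ.< z l ⊎ (z k ℚ.+ 1ℚ ≡ z l × u k ℚ.< u l)
      split (tri< p _ _) = inj₁ p
      split (tri≈ _ p _) = inj₂ (p , u-rise {k} {l} (z l) (tilt k) (tilt l) (sym p)
        (steps-bound (k == i) (k == j) (l == i) (l == j) (not-both ne)))
      -- Excluded by minimality: after division by `d` every arrow has height at least 1.
      split (tri> _ _ p) = ⊥-elim (ℚP.<-irrefl refl (ℚP.<-≤-trans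
        (<-shift {z l} {z k ℚ.+ 1ℚ} {z l ℚ.- z k} {1ℚ}
          (solve 2 (λ a b → (a :+ con 1ℚ) :- b := con 1ℚ :- (b :- a)) refl (z k) (z l)) p)
        (subst₂ ℚ._≤_ dr≡1 (z-diff k l)
          (ℚP.*-monoʳ-≤-nonNeg r {{ℚP.pos⇒nonNeg r {{ℚ.positive 0<r}}}} (least k l t)))))

    -- A height difference below 1 becomes one below `r` < 1 after the division, so pairs without an
    -- arrow are never tied and no choice of tilt can spoil them.
    blank : ∀ {k l} → Edge G k l → τ G x k l ≡ false → z l ℚ.< z k ℚ.+ 1ℚ
    blank {k} {l} e f = <-shift {z l ℚ.- z k} {1ℚ}
      (solve 2 (λ a b → con 1ℚ :- (b :- a) := (a :+ con 1ℚ) :- b) refl (z k) (z l))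
      (ℚP.<-trans
        (subst₂ ℚ._<_ (z-diff k l) (ℚP.*-identityˡ r) (ℚP.*-monoˡ-<-pos r {{ℚ.positive 0<r}}
          (<-shift {x l} {x k ℚ.+ 1ℚ} {x l ℚ.- x k} {1ℚ}
            (solve 2 (λ a b → (a :+ con 1ℚ) :- b := con 1ℚ :- (b :- a)) refl (x k) (x l))
            (τ-below G x gen e f))))
        r<1)

    steep : three ℚ.< tilt i ℚ.- tilt j
    steep = subst₂ (λ s t → three ℚ.< s ℚ.- t)
      (sym (cong₂ steps (dec-true (i ≟ i) refl) (dec-false (i ≟ j) i≢j)))
      (sym (cong₂ steps (dec-false (j ≟ i) (i≢j ∘ sym)) (dec-true (j ≟ j) refl))) steps-steep

    up : ∀ k l → Edge G k l → target k l ≡ true →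
      z k ℚ.+ 1ℚ ℚ.< z l ⊎ (z k ℚ.+ 1ℚ ≡ z l × u k ℚ.< u l)
    up k l e t = arrow (trans (sym (setPair-off (τ G x) i j false k l ne)) t) ne
      where
      ne : ¬ (k ≡ i × l ≡ j)
      ne (refl , refl) = true≢false t (setPair-at (τ G x) i j false)

    down : ∀ k l → Edge G k l → target k l ≡ false →
      z l ℚ.< z k ℚ.+ 1ℚ ⊎ (z k ℚ.+ 1ℚ ≡ z l × u l ℚ.< u k)
    down k l e f = split (k ≟ i) (l ≟ j)
      where
      off : ¬ (k ≡ i × l ≡ j) → z l ℚ.< z k ℚ.+ 1ℚ
      off ne = blank e (trans (sym (setPair-off (τ G x) i j false k l ne)) f)
      split : Dec (k ≡ i) → Dec (l ≡ j) → z l ℚ.< z k ℚ.+ 1ℚ ⊎ (z k ℚ.+ 1ℚ ≡ z l × u l ℚ.< u k)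
      split (no ¬p) _            = inj₁ (off (¬p ∘ proj₁))
      split (yes _) (no ¬q)      = inj₁ (off (¬q ∘ proj₂))
      split (yes refl) (yes refl) = inj₂ (z-ij , u-fall {i} (z j) (tilt i) (tilt j) (sym z-ij) steep)

abstract
  descend : ∀ {m} (G : Graph m) {x : Point m} {n} → Generic G x → level (τ G x) ≡ suc n →
    ∃ λ y → Generic G y × ∃ λ i → ∃ λ j → Cover (τ G y) (τ G x) i j
  -- The minimum is taken over the codes of pairs that `level` counts, so a positive level supplies
  -- a candidate.
  descend {m} G {x} gen h with argmin (λ k → uncurry (τ G x) (remQuot {m} m k))
      (λ k → x (proj₂ (remQuot {m} m k)) ℚ.- x (proj₁ (remQuot {m} m k)))
      (count-positive (λ k → uncurry (τ G x) (remQuot {m} m k)) h)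
  ... | c , ij , least = y , realises⇒generic G {target} R , i , j ,
        cover-respˡ (realises⇒≗O G {target} target-⊆E R) (cover-unset (τ G x) i j ij)
    where
    i j : Fin m
    i = proj₁ (remQuot {m} m c)
    j = proj₂ (remQuot {m} m c)
    open Descent G x gen i j ij (λ k l t →
      subst (λ p → x j ℚ.- x i ℚ.≤ x (proj₂ p) ℚ.- x (proj₁ p)) (FinP.remQuot-combine k l)
        (least (combine k l) (trans (cong (uncurry (τ G x)) (FinP.remQuot-combine k l)) t)))
    realised : ∃ λ y → Realises G target y
    realised = lowered (inverse (x j ℚ.- x i) 1<d)
    y : Point m
    y = proj₁ realised
    R : Realises G target y
    R = proj₂ realised

-- Fourier–Motzkin elimination for difference constraints

p-1<p : ∀ p → p ℚ.- 1ℚ ℚ.< p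
p-1<p p = <-shift (solve 1 (λ p → con 1ℚ :- con 0ℚ := p :- (p :- con 1ℚ)) refl p) 0<1
  where open +-*-Solver

below-all : ∀ us → ∃ λ t → All (t ℚ.<_) us
below-all []       = 0ℚ , []
below-all (u ∷ us) with below-all us
... | t , t< with ℚP.≤-total u t
...   | inj₁ u≤t = u ℚ.- 1ℚ , p-1<p u ∷ All.map (ℚP.<-trans (ℚP.<-≤-trans (p-1<p u) u≤t)) t<
...   | inj₂ t≤u = t ℚ.- 1ℚ , ℚP.<-≤-trans (p-1<p t) t≤u ∷ All.map (ℚP.<-trans (p-1<p t)) t<

squeeze : ∀ l us → All (l ℚ.<_) us → ∃ λ t → l ℚ.< t × All (t ℚ.<_) us
squeeze l []       []         = l ℚ.+ 1ℚ , p<p+1 l , []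
squeeze l (u ∷ us) (l<u ∷ l<) with squeeze l us l< | ℚP.<-dense l<u
... | t , l<t , t< | s , l<s , s<u with ℚP.≤-total s t
...   | inj₁ s≤t = s , l<s , s<u ∷ All.map (ℚP.≤-<-trans s≤t) t<
...   | inj₂ t≤s = t , l<t , ℚP.≤-<-trans t≤s s<u ∷ t<

-- Lower bounds enter one at a time. If the current `t` is not above the new bound `l`, `squeeze`
-- finds a point just above `l`; it exceeds `t` and so respects the earlier lower bounds.
between : ∀ ls us → (∀ {l u} → l ∈ ls → u ∈ us → l ℚ.< u) →
  ∃ λ t → All (ℚ._< t) ls × All (t ℚ.<_) us
between []       us h with below-all us
... | t , t< = t , [] , t<
between (l ∷ ls) us h with between ls us (λ p q → h (there p) q)
... | t , <t , t< with ℚP.<-cmp l t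
...   | tri< l<t _ _  = t , l<t ∷ <t , t<
...   | tri≈ _ refl _ with squeeze l us t<
...     | s , l<s , s< = s , l<s ∷ All.map (λ p → ℚP.<-trans p l<s) <t , s<
between (l ∷ ls) us h | t , <t , t< | tri> _ _ t<l with squeeze l us (All.tabulate (h (here refl)))
... | s , l<s , s< = s , l<s ∷ All.map (λ p → ℚP.<-trans p (ℚP.<-trans t<l l<s)) <t , s<

Constraint : ℕ → Set
Constraint n = Fin n × ℚ × Fin n

Sat : ∀ {n} → Point n → Constraint n → Set
Sat x (a , c , b) = x a ℚ.+ c ℚ.< x b

lowers : ∀ {n} → List (Constraint (suc n)) → List (Fin n × ℚ)
lowers []                          = []
lowers ((zero  , c , zero)  ∷ L)   = lowers L
lowers ((zero  , c , suc b) ∷ L)   = lowers L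
lowers ((suc a , c , zero)  ∷ L)   = (a , c) ∷ lowers L
lowers ((suc a , c , suc b) ∷ L)   = lowers L

uppers : ∀ {n} → List (Constraint (suc n)) → List (ℚ × Fin n)
uppers []                          = []
uppers ((zero  , c , zero)  ∷ L)   = uppers L
uppers ((zero  , c , suc b) ∷ L)   = (c , b) ∷ uppers L
uppers ((suc a , c , zero)  ∷ L)   = uppers L
uppers ((suc a , c , suc b) ∷ L)   = uppers L

-- A constraint of the eliminated variable against itself bounds it on neither side; it holds
-- exactly when its constant is negative.
selfs : ∀ {n} → List (Constraint (suc n)) → List ℚ
selfs []                           = []
selfs ((zero  , c , zero)  ∷ L)    = c ∷ selfs L
selfs ((zero  , c , suc b) ∷ L)    = selfs L
selfs ((suc a , c , zero)  ∷ L)    = selfs L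
selfs ((suc a , c , suc b) ∷ L)    = selfs L

rests : ∀ {n} → List (Constraint (suc n)) → List (Constraint n)
rests []                           = []
rests ((zero  , c , zero)  ∷ L)    = rests L
rests ((zero  , c , suc b) ∷ L)    = rests L
rests ((suc a , c , zero)  ∷ L)    = rests L
rests ((suc a , c , suc b) ∷ L)    = (a , c , b) ∷ rests L

extend : ∀ {n} → ℚ → Point n → Point (suc n)
extend t y zero    = t
extend t y (suc i) = y i

lowerValue : ∀ {n} → Point n → Fin n × ℚ → ℚ
lowerValue y (a , c) = y a ℚ.+ c

upperValue : ∀ {n} → Point n → ℚ × Fin n → ℚ
upperValue y (c , b) = y b ℚ.- c

module _ {n} (y : Point n) (t : ℚ) where

  Split : List (Constraint (suc n)) → Set
  Split L = All (λ p → lowerValue y p ℚ.< t) (lowers L) × All (λ q → t ℚ.< upperValue y q) (uppers L) ×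
            All (ℚ._< 0ℚ) (selfs L) × All (Sat y) (rests L)

  private
    open +-*-Solver
    upper⁺ : ∀ {u} c → t ℚ.+ c ℚ.< u → t ℚ.< u ℚ.- c
    upper⁺ {u} c = <-shift (solve 3 (λ t c u → u :- (t :+ c) := (u :- c) :- t) refl t c u)
    upper⁻ : ∀ {u} c → t ℚ.< u ℚ.- c → t ℚ.+ c ℚ.< u
    upper⁻ {u} c = <-shift (solve 3 (λ t c u → (u :- c) :- t := u :- (t :+ c)) refl t c u)
    self⁺ : ∀ c → t ℚ.+ c ℚ.< t → c ℚ.< 0ℚ
    self⁺ c = <-shift (solve 2 (λ t c → t :- (t :+ c) := con 0ℚ :- c) refl t c)
    self⁻ : ∀ c → c ℚ.< 0ℚ → t ℚ.+ c ℚ.< t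
    self⁻ c = <-shift (solve 2 (λ t c → con 0ℚ :- c := t :- (t :+ c)) refl t c)

  split⁺ : ∀ L → All (Sat (extend t y)) L → Split L
  split⁺ []                        []       = [] , [] , [] , []
  split⁺ ((zero  , c , zero)  ∷ L) (s ∷ ss) with split⁺ L ss
  ... | l , u , z , r = l , u , self⁺ c s ∷ z , r
  split⁺ ((zero  , c , suc b) ∷ L) (s ∷ ss) with split⁺ L ss
  ... | l , u , z , r = l , upper⁺ c s ∷ u , z , r
  split⁺ ((suc a , c , zero)  ∷ L) (s ∷ ss) with split⁺ L ss
  ... | l , u , z , r = s ∷ l , u , z , r
  split⁺ ((suc a , c , suc b) ∷ L) (s ∷ ss) with split⁺ L ss
  ... | l , u , z , r = l , u , z , s ∷ r

  split⁻ : ∀ L → Split L → All (Sat (extend t y)) L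
  split⁻ []                        _                   = []
  split⁻ ((zero  , c , zero)  ∷ L) (l , u , s ∷ z , r) = self⁻ c s ∷ split⁻ L (l , u , z , r)
  split⁻ ((zero  , c , suc b) ∷ L) (l , s ∷ u , z , r) = upper⁻ c s ∷ split⁻ L (l , u , z , r)
  split⁻ ((suc a , c , zero)  ∷ L) (s ∷ l , u , z , r) = s ∷ split⁻ L (l , u , z , r)
  split⁻ ((suc a , c , suc b) ∷ L) (l , u , z , s ∷ r) = s ∷ split⁻ L (l , u , z , r)

-- Adding a lower and an upper bound on the eliminated variable cancels it and leaves a difference
-- constraint, so elimination stays inside this class.
join : ∀ {n} → Fin n × ℚ → ℚ × Fin n → Constraint n
join (a , c) (c′ , b) = a , c ℚ.+ c′ , b

eliminate : ∀ {n} → List (Constraint (suc n)) → List (Constraint n)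
eliminate L = cartesianProductWith join (lowers L) (uppers L) ++ rests L

eliminate⁺ : ∀ {n} (x : Point (suc n)) L → All (Sat x) L →
  All (ℚ._< 0ℚ) (selfs L) × All (Sat (x ∘ suc)) (eliminate L)
eliminate⁺ x L ss with split⁺ (x ∘ suc) (x zero) L (All.map (λ {c} → eta c) ss)
  where
  eta : ∀ c → Sat x c → Sat (extend (x zero) (x ∘ suc)) c
  eta (zero  , c , zero)  s = s
  eta (zero  , c , suc b) s = s
  eta (suc a , c , zero)  s = s
  eta (suc a , c , suc b) s = s
... | l , u , z , r = z , AllP.++⁺ (All.tabulate joined) r
  where
  joined : ∀ {c} → c ∈ cartesianProductWith join (lowers L) (uppers L) → Sat (x ∘ suc) c
  joined c∈ with ∈-cartesianProductWith⁻ join (lowers L) (uppers L) c∈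
  ... | (a , c) , (c′ , b) , p∈ , q∈ , refl = <-shift
    (solve 4 (λ a c c′ b → (b :- c′) :- (a :+ c) := b :- (a :+ (c :+ c′))) refl
      (x (suc a)) c c′ (x (suc b)))
    (ℚP.<-trans (All.lookup l p∈) (All.lookup u q∈))
    where open +-*-Solver

-- The joined constraints say that every lower value is below every upper value. As ℚ is dense and
-- unbounded, a value between them exists, so no solutions are lost.
eliminate⁻ : ∀ {n} (y : Point n) L → All (ℚ._< 0ℚ) (selfs L) → All (Sat y) (eliminate L) →
  ∃ λ t → All (Sat (extend t y)) L
eliminate⁻ y L z ss with AllP.++⁻ (cartesianProductWith join (lowers L) (uppers L)) ss
... | js , r with between (map (lowerValue y) (lowers L)) (map (upperValue y) (uppers L)) apart
  where
  apart : ∀ {p q} → p ∈ map (lowerValue y) (lowers L) → q ∈ map (upperValue y) (uppers L) → p ℚ.< q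
  apart p∈ q∈ with ∈-map⁻ (lowerValue y) p∈ | ∈-map⁻ (upperValue y) q∈
  ... | (a , c) , a∈ , refl | (c′ , b) , b∈ , refl = <-shift
    (solve 4 (λ a c c′ b → b :- (a :+ (c :+ c′)) := (b :- c′) :- (a :+ c)) refl (y a) c c′ (y b))
    (All.lookup js (∈-cartesianProductWith⁺ join a∈ b∈))
    where open +-*-Solver
...   | t , <t , t< = t , split⁻ y t L (AllP.map⁻ <t , AllP.map⁻ t< , z , r)

satisfiable? : ∀ {n} (L : List (Constraint n)) → Dec (∃ λ x → All (Sat x) L)
satisfiable? {zero}  []             = yes ((λ ()) , [])
satisfiable? {zero}  ((() , _) ∷ _)
satisfiable? {suc n} L = map′
  (λ { (z , y , ss) → extend _ y , proj₂ (eliminate⁻ y L z ss) })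
  (λ { (x , ss) → proj₁ (eliminate⁺ x L ss) , x ∘ suc , proj₂ (eliminate⁺ x L ss) })
  (All.all? (ℚP._<? 0ℚ) (selfs L) ×-dec satisfiable? (eliminate L))

module _ {m} (G : Graph m) (P : POr m) where

  private
    constraint : Fin m → Fin m → Constraint m
    constraint k l = if P k l then (k , 1ℚ , l) else (l , ℚ.- 1ℚ , k)

    constraints : List (Fin m × Fin m) → List (Constraint m)
    constraints []             = []
    constraints ((k , l) ∷ ps) = if E G k l then constraint k l ∷ constraints ps else constraints ps

    Realised : Point m → Fin m × Fin m → Set
    Realised y (k , l) = Edge G k l → (P k l ≡ true → Above y k l) × (P k l ≡ false → y l ℚ.< y k ℚ.+ 1ℚ)

    open +-*-Solver

    constraint⁺ : ∀ y k l → (P k l ≡ true → Above y k l) × (P k l ≡ false → y l ℚ.< y k ℚ.+ 1ℚ) →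
      Sat y (constraint k l)
    constraint⁺ y k l (t , f) with P k l
    ... | true  = t refl
    ... | false = <-shift (solve 2 (λ a b → (a :+ con 1ℚ) :- b := a :- (b :+ con (ℚ.- 1ℚ))) refl (y k) (y l))
                    (f refl)

    constraint⁻ : ∀ y k l → Sat y (constraint k l) →
      (P k l ≡ true → Above y k l) × (P k l ≡ false → y l ℚ.< y k ℚ.+ 1ℚ)
    constraint⁻ y k l s with P k l
    ... | true  = (λ _ → s) , λ ()
    ... | false = (λ ()) , λ _ →
      <-shift (solve 2 (λ a b → a :- (b :+ con (ℚ.- 1ℚ)) := (a :+ con 1ℚ) :- b) refl (y k) (y l)) s

    constraints⁺ : ∀ y ps → All (Realised y) ps → All (Sat y) (constraints ps)
    constraints⁺ y []             []       = []
    constraints⁺ y ((k , l) ∷ ps) (r ∷ rs) with E G k l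
    ... | true  = constraint⁺ y k l (r refl) ∷ constraints⁺ y ps rs
    ... | false = constraints⁺ y ps rs

    constraints⁻ : ∀ y ps → All (Sat y) (constraints ps) → All (Realised y) ps
    constraints⁻ y []             []       = []
    constraints⁻ y ((k , l) ∷ ps) ss       with E G k l in ¬e
    constraints⁻ y ((k , l) ∷ ps) (s ∷ ss) | true  = (λ _ → constraint⁻ y k l s) ∷ constraints⁻ y ps ss
    constraints⁻ y ((k , l) ∷ ps) ss       | false = (λ e → ⊥-elim (true≢false e ¬e)) ∷ constraints⁻ y ps ss

  -- Tells the search whether a region with a prescribed set of arrows exists, and supplies a point
  -- of it to put in the queue.
  realisable? : Dec (∃ λ y → Realises G P y)
  realisable? = map′
    (λ { (y , ss) → y , λ k l →
           All.lookup (constraints⁻ y pairs ss) (∈-cartesianProduct⁺ (∈-allFin k) (∈-allFin l)) })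
    (λ { (y , R) → y , constraints⁺ y pairs (All.tabulate (λ {p} _ → R (proj₁ p) (proj₂ p))) })
    (satisfiable? (constraints pairs))
    where
    pairs = cartesianProduct (allFin m) (allFin m)

sameRegion? : ∀ {m} (G : Graph m) (x y : Point m) → Dec (SameRegion G x y)
sameRegion? G x y = map′ (≗O⇒sameRegion G) (sameRegion⇒≗O G)
  (FinP.all? λ i → FinP.all? λ j → τ G x i j Bool.≟ τ G y i j)

labelled? : ∀ {m} (G : Graph m) L (y : Point m) → Dec (Labelled G L y)
labelled? G L y = any? (λ e → sameRegion? G (proj₁ e) y) L

-- The breadth-first search

origin-¬above : ∀ {m} (i j : Fin m) → ¬ Above (origin {m}) i j
origin-¬above i j p = ℚP.<-asym 0<1 (subst (ℚ._< 0ℚ) (ℚP.+-identityˡ 1ℚ) p)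

τ-origin : ∀ {m} (G : Graph m) i j → τ G origin i j ≡ false
τ-origin G i j = τ-false G origin (origin-¬above i j)

origin-generic : ∀ {m} (G : Graph m) → Generic G origin
origin-generic G i j e ()

ψ-τ-origin : ∀ {m} (G : Graph m) → minusOneV ≗D ψ (τ G origin)
ψ-τ-origin G v = cong (λ k → + k ℤ.- + 1) (sym (count-false (λ u → τ-origin G u v)))

level-≤ : ∀ {m} (O : POr m) → level O ℕ.≤ m ℕ.* m
level-≤ O = count-≤ _

level≡0⇒central : ∀ {m} (G : Graph m) {x : Point m} → level (τ G x) ≡ 0 → τ G origin ≗O τ G x
level≡0⇒central G h i j = trans (τ-origin G i j) (sym (level≡0 h i j))

labelled-resp : ∀ {m} (G : Graph m) L {x y : Point m} → SameRegion G x y → Labelled G L x → Labelled G L y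
labelled-resp G L s = Any.map (λ t → sameRegion-trans G t s)

cover-edge : ∀ {m} (G : Graph m) {O : POr m} {y : Point m} {i j} → Cover O (τ G y) i j → Edge G i j
cover-edge G {y = y} c = τ-edge G y (Cover.upper c)

-- The reverse arrow is absent at `x`: it would persist at `y` next to the arrow (i , j), and each
-- of the two heights would exceed the other.
cover-blank : ∀ {m} (G : Graph m) {x y : Point m} → Generic G x → ∀ {i j} →
  Cover (τ G x) (τ G y) i j → Blank x i j
cover-blank G {x} {y} gen {i} {j} c =
  τ-below G x gen (trans (E-sym G j i) e) (≢true⇒≡false not-back) , τ-below G x gen e lower
  where
  open Cover c
  e = cover-edge G {y = y} c
  not-back : τ G x j i ≢ true
  not-back t with j ≟ i
  ... | yes refl = true≢false t lower
  ... | no j≢i   = Above-asym y (τ-above G y upper)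
                     (τ-above G y (trans (sym (other j i (j≢i ∘ proj₁))) t))

module Search {m} (G : Graph m) where

  lev : Point m → ℕ
  lev x = level (τ G x)

  _⋖_ : Point m → Point m → Set
  x ⋖ y = ∃ λ i → ∃ λ j → Cover (τ G x) (τ G y) i j

  ⋖-lev : ∀ {x y} → x ⋖ y → lev y ≡ suc (lev x)
  ⋖-lev (_ , _ , c) = level-cover c

  sameRegion-lev : ∀ {x y} → SameRegion G x y → lev x ≡ lev y
  sameRegion-lev s = level-cong (sameRegion⇒≗O G s)

  -- The outcome of the `visit` steps from `r` across the pairs `ps`. Only regions with one arrow
  -- more occur, since `visit` asks for a blank edge at `r`. The field `source` says that nothing
  -- else has been labelled.
  record Scanned (r : Point m) (ps : List (Fin m × Fin m)) (q : List (Point m)) (L : Labelling m) : Set where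
    field
      new     : List (Point m)
      labels  : Labelling m
      path    : Star (BFSStep G) ⟨ just r , q , L ⟩ ⟨ just r , q ++ new , labels ⟩
      keeps   : ∀ {y} → Labelled G L y → Labelled G labels y
      source  : ∀ {e} → e ∈ labels → e ∈ L ⊎ proj₁ e ∈ new
      upper   : ∀ {y} → y ∈ new → Generic G y × lev y ≡ suc (lev r) × Labelled G labels y
      covered : ∀ {i j} → (i , j) ∈ ps → ∀ y → Generic G y → Cover (τ G r) (τ G y) i j → Labelled G labels y

  scan : ∀ r → Generic G r → ∀ ps q L → Labelled G L r → Scanned r ps q L
  scan r gen [] q L lab = record
    { new = [] ; labels = L
    ; path = subst (λ q′ → Star (BFSStep G) ⟨ just r , q , L ⟩ ⟨ just r , q′ , L ⟩) (sym (++-identityʳ q)) stay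
    ; keeps = id ; source = inj₁ ; upper = λ () ; covered = λ () }
  scan r gen ((i , j) ∷ ps) q L lab = consider (E G i j Bool.≟ true) (τ G r i j Bool.≟ false)
                                               (realisable? G target)
    where
    target : POr m
    target = setPair (τ G r) i j true

    cover⇒target : ∀ {y} → Cover (τ G r) (τ G y) i j → target ≗O τ G y
    cover⇒target c k l with k ≟ i | l ≟ j
    ... | yes refl | yes refl = sym (Cover.upper c)
    ... | yes _    | no l≢j   = Cover.other c k l (l≢j ∘ proj₂)
    ... | no k≢i   | _        = Cover.other c k l (k≢i ∘ proj₁)

    target≗ : ∀ {y} → Edge G i j → Realises G target y → target ≗O τ G y
    target≗ e = realises⇒≗O G {target} ⊆E
      where
      ⊆E : ∀ k l → target k l ≡ true → Edge G k l
      ⊆E k l t with k ≟ i | l ≟ j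
      ... | yes refl | yes refl = e
      ... | yes _    | no _     = τ-edge G r t
      ... | no _     | _        = τ-edge G r t

    same : ∀ {y} → Edge G i j → Realises G target y → ∀ {z} → Cover (τ G r) (τ G z) i j → SameRegion G y z
    same {y} e R {z} c =
      ≗O⇒sameRegion G (λ k l → trans (sym (target≗ {y} e R k l)) (cover⇒target {z} c k l))

    skip : (∀ y → Generic G y → Cover (τ G r) (τ G y) i j → Labelled G L y) → Scanned r ((i , j) ∷ ps) q L
    skip done = record
      { new = new ; labels = labels ; path = path ; keeps = keeps ; source = source ; upper = upper
      ; covered = λ { (here refl) y g c → keeps (done y g c) ; (there p) → covered p } }
      where open Scanned (scan r gen ps q L lab)

    take : ∀ y → Edge G i j → τ G r i j ≡ false → Realises G target y → ¬ Labelled G L y →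
      Scanned r ((i , j) ∷ ps) q L
    take y e f R fresh = record
      { new = y ∷ new ; labels = labels
      ; path = visit r q L _ y i j (proj₂ (label lab)) gen-y (cover⇒bordering G c) fresh e
                 (cover-blank G {y = y} gen c) (τ-above G y (Cover.upper c))
               ◅ subst (λ q′ → Star (BFSStep G) ⟨ just r , q ++ [ y ] , L′ ⟩ ⟨ just r , q′ , labels ⟩) (++-assoc q [ y ] new) path
      ; keeps = λ p → keeps (AnyP.++⁺ˡ p)
      ; source = λ p → origins (source p)
      ; upper = λ { (here refl) → gen-y , level-cover c , keeps y-labelled ; (there p) → upper p }
      ; covered = λ { (here refl) z g c′ → keeps (labelled-resp G L′ (same {y} e R {_} c′) y-labelled)
                    ; (there p) → covered p } }
      where
      gen-y : Generic G y
      gen-y = realises⇒generic G {target} R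
      c : Cover (τ G r) (τ G y) i j
      c = cover-respʳ (target≗ {y} e R) (cover-set (τ G r) i j f)
      label : ∀ {M} → Labelled G M r → ∃ λ d → Any (λ e → SameRegion G (proj₁ e) r × proj₂ e ≡ d) M
      label (here s)  = _ , here (s , refl)
      label (there p) = _ , there (proj₂ (label p))
      L′ : Labelling m
      L′ = L ++ [ (y , addV (proj₁ (label lab)) j) ]
      y-labelled : Labelled G L′ y
      y-labelled = AnyP.++⁺ʳ L (here (sameRegion-refl G))
      open Scanned (scan r gen ps (q ++ [ y ]) L′ (AnyP.++⁺ˡ lab))
      origins : ∀ {e} → e ∈ L′ ⊎ proj₁ e ∈ new → e ∈ L ⊎ proj₁ e ∈ y ∷ new
      origins (inj₂ p) = inj₂ (there p)
      origins (inj₁ p) with ∈-++⁻ L p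
      ... | inj₁ p′          = inj₁ p′
      ... | inj₂ (here refl) = inj₂ (here refl)

    consider : Dec (Edge G i j) → Dec (τ G r i j ≡ false) → Dec (∃ λ y → Realises G target y) →
      Scanned r ((i , j) ∷ ps) q L
    consider (no ¬e) _ _ = skip (λ y g c → ⊥-elim (¬e (cover-edge G {y = y} c)))
    consider _ (no ¬f) _ = skip (λ y g c → ⊥-elim (¬f (Cover.lower c)))
    consider _ _ (no ¬R) = skip (λ y g c → ⊥-elim (¬R (y , generic⇒realises G {target} g (cover⇒target {y} c))))
    consider (yes e) (yes f) (yes (y , R)) with labelled? G L y
    ... | no fresh = take y e f R fresh
    ... | yes p    = skip (λ z g c → labelled-resp G L (same {y} e R {z} c) p)

  -- The queue is `A ++ B`: the unprocessed part of layer `n`, followed by the part of layer `n + 1`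
  -- found so far. By `frontier`, a region of layer `n + 1` is in `B` or is still reachable from
  -- `A`.
  record Layered (n : ℕ) (A B : List (Point m)) (L : Labelling m) : Set where
    field
      layer-A  : ∀ {a} → a ∈ A → Generic G a × lev a ≡ n × Labelled G L a
      layer-B  : ∀ {b} → b ∈ B → Generic G b × lev b ≡ suc n × Labelled G L b
      below    : ∀ y → Generic G y → lev y ℕ.≤ n → Labelled G L y
      frontier : ∀ y → Generic G y → lev y ≡ suc n → Any (λ b → SameRegion G b y) B ⊎ Any (_⋖ y) A
      recorded : ∀ {e} → e ∈ L → lev (proj₁ e) ℕ.≤ n ⊎ Any (λ b → SameRegion G b (proj₁ e)) B

  pairs : List (Fin m × Fin m)
  pairs = cartesianProduct (allFin m) (allFin m)

  drain : ∀ {n} A B L → Layered n A B L →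
    ∃ λ B′ → ∃ λ L′ → Star (BFSStep G) ⟨ nothing , A ++ B , L ⟩ ⟨ nothing , B′ , L′ ⟩ × Layered n [] B′ L′
  drain     []      B L inv = B , L , stay , inv
  drain {n} (r ∷ A) B L inv = B″ , L″ , pop r (A ++ B) L ◅ (path ◅◅ (finish r _ labels closed ◅
      subst (λ q → Star (BFSStep G) ⟨ nothing , q , labels ⟩ ⟨ nothing , B″ , L″ ⟩) (sym (++-assoc A B new)) rest)) ,
      inv″
    where
    open Layered inv
    r-facts = layer-A (here refl)
    open Scanned (scan r (proj₁ r-facts) pairs (A ++ B) L (proj₂ (proj₂ r-facts)))

    lev-r : lev r ≡ n
    lev-r = proj₁ (proj₂ r-facts)

    closed-up : ∀ y → Generic G y → r ⋖ y → Labelled G labels y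
    closed-up y g (i , j , c) = covered (∈-cartesianProduct⁺ (∈-allFin i) (∈-allFin j)) y g c

    closed : ∀ y → Generic G y → Bordering G r y → Labelled G labels y
    closed y g b with bordering⇒cover G {r} {y} b
    ... | inj₁ c = closed-up y g c
    -- A neighbour with an arrow less cannot be visited from `r`; it belongs to an earlier layer,
    -- which is already complete.
    ... | inj₂ c = keeps (below y g
      (ℕP.≤-trans (ℕP.n≤1+n _) (ℕP.≤-reflexive (trans (sym (⋖-lev {y} {r} c)) lev-r))))

    recorded′ : ∀ {e} → e ∈ labels → lev (proj₁ e) ℕ.≤ n ⊎ Any (λ b → SameRegion G b (proj₁ e)) (B ++ new)
    recorded′ p with source p
    ... | inj₂ e∈new = inj₂ (AnyP.++⁺ʳ B (Any.map (λ { refl → sameRegion-refl G }) e∈new))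
    ... | inj₁ e∈L with recorded e∈L
    ...   | inj₁ le = inj₁ le
    ...   | inj₂ b  = inj₂ (AnyP.++⁺ˡ b)

    -- A region above `r` may have been labelled from an earlier member of the layer. Having `n + 1`
    -- arrows, it shares its region with an entry recorded in `B` or just added.
    queued : ∀ {y} → lev y ≡ suc n → Labelled G labels y → Any (λ b → SameRegion G b y) (B ++ new)
    queued {y} h p with find p
    ... | e , e∈ , s with recorded′ e∈
    ...   | inj₂ b  = Any.map (λ t → sameRegion-trans G t s) b
    ...   | inj₁ le = ⊥-elim (ℕP.1+n≰n (subst (ℕ._≤ n) (trans (sameRegion-lev s) h) le))

    frontier′ : ∀ y → Generic G y → lev y ≡ suc n →
      Any (λ b → SameRegion G b y) (B ++ new) ⊎ Any (_⋖ y) A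
    frontier′ y g h with frontier y g h
    ... | inj₁ b         = inj₁ (AnyP.++⁺ˡ b)
    ... | inj₂ (there a) = inj₂ a
    ... | inj₂ (here c)  = inj₁ (queued h (closed-up y g c))

    layer-B′ : ∀ {b} → b ∈ B ++ new → Generic G b × lev b ≡ suc n × Labelled G labels b
    layer-B′ p with ∈-++⁻ B p
    ... | inj₁ p′ = proj₁ (layer-B p′) , proj₁ (proj₂ (layer-B p′)) , keeps (proj₂ (proj₂ (layer-B p′)))
    ... | inj₂ p′ = proj₁ (upper p′) , trans (proj₁ (proj₂ (upper p′))) (cong suc lev-r) , proj₂ (proj₂ (upper p′))

    inv′ : Layered n A (B ++ new) labels
    inv′ = record
      { layer-A  = λ p → proj₁ (layer-A (there p)) , proj₁ (proj₂ (layer-A (there p))) ,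
                         keeps (proj₂ (proj₂ (layer-A (there p))))
      ; layer-B  = layer-B′
      ; below    = λ y g le → keeps (below y g le)
      ; frontier = frontier′
      ; recorded = recorded′
      }

    remaining = drain A (B ++ new) labels inv′
    B″   = proj₁ remaining
    L″   = proj₁ (proj₂ remaining)
    rest = proj₁ (proj₂ (proj₂ remaining))
    inv″ = proj₂ (proj₂ (proj₂ remaining))

  -- Here the descent is used: a region with `n + 2` arrows lies above one with `n + 1`, and with
  -- `A` empty that one is represented in `B`.
  next-layer : ∀ {n B L} → Layered n [] B L → Layered (suc n) B [] L
  next-layer {n} {B} {L} inv = record
    { layer-A  = layer-B
    ; layer-B  = λ ()
    ; below    = below′
    ; frontier = λ y g h → inj₂ (frontier′ y g h)
    ; recorded = λ p → inj₁ (recorded′ p)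
    }
    where
    open Layered inv
    in-B : ∀ y → Generic G y → lev y ≡ suc n → Any (λ b → SameRegion G b y) B
    in-B y g h with frontier y g h
    ... | inj₁ b = b
    below′ : ∀ y → Generic G y → lev y ℕ.≤ suc n → Labelled G L y
    below′ y g le with ℕP.m≤n⇒m<n∨m≡n le
    ... | inj₁ lt = below y g (ℕP.≤-pred lt)
    ... | inj₂ h with find (in-B y g h)
    ...   | b , b∈ , s = labelled-resp G L s (proj₂ (proj₂ (layer-B b∈)))
    frontier′ : ∀ y → Generic G y → lev y ≡ suc (suc n) → Any (_⋖ y) B
    frontier′ y g h with descend G g h
    ... | z , gz , i , j , c = Any.map (λ s → i , j , cover-respˡ (λ k l → sym (sameRegion⇒≗O G s k l)) c)
      (in-B z gz (ℕP.suc-injective (trans (sym (level-cover c)) h)))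
    recorded′ : ∀ {e} → e ∈ L → lev (proj₁ e) ℕ.≤ suc n
    recorded′ p with recorded p
    ... | inj₁ le = ℕP.m≤n⇒m≤1+n le
    ... | inj₂ b with find b
    ...   | _ , b∈ , s = ℕP.≤-reflexive (trans (sym (sameRegion-lev s)) (proj₁ (proj₂ (layer-B b∈))))

  -- The fuel counts layers. At most `m * m` ordered pairs can be arrows, so a nonempty layer `n`
  -- forces `n` ≤ `m * m`.
  exhaust : ∀ fuel {n} A L → Layered n A [] L → m ℕ.* m ℕ.< n ℕ.+ fuel →
    ∃ λ L′ → Star (BFSStep G) ⟨ nothing , A , L ⟩ ⟨ nothing , [] , L′ ⟩
  exhaust _          []      L inv h = L , stay
  exhaust zero       {n} (a ∷ A) L inv h = ⊥-elim (ℕP.<⇒≱ (subst (m ℕ.* m ℕ.<_) (ℕP.+-identityʳ n) h)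
    (subst (ℕ._≤ m ℕ.* m) (proj₁ (proj₂ (Layered.layer-A inv (here refl)))) (level-≤ (τ G a))))
  exhaust (suc fuel) {n} (a ∷ A) L inv h with drain (a ∷ A) [] L inv
  ... | B , L₁ , path , inv₁ with exhaust fuel B L₁ (next-layer inv₁) (subst (m ℕ.* m ℕ.<_) (ℕP.+-suc n fuel) h)
  ...   | L₂ , rest = L₂ , subst (λ q → Star (BFSStep G) ⟨ nothing , q , L ⟩ ⟨ nothing , B , L₁ ⟩) (++-identityʳ (a ∷ A)) path ◅◅ rest

  initial-layer : Layered 0 [ origin ] [] [ (origin , minusOneV) ]
  initial-layer = record
    { layer-A  = λ { (here refl) → origin-generic G , origin-level , here (sameRegion-refl G) }
    ; layer-B  = λ ()
    ; below    = λ y g le → here (≗O⇒sameRegion G (level≡0⇒central G {y} (ℕP.n≤0⇒n≡0 le)))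
    ; frontier = λ y g h → inj₂ (here (up y g h))
    ; recorded = λ { (here refl) → inj₁ (ℕP.≤-reflexive origin-level) }
    }
    where
    origin-level : lev origin ≡ 0
    origin-level = count-false {m ℕ.* m} {λ k → uncurry (τ G origin) (remQuot {m} m k)}
      (λ k → uncurry (τ-origin G) (remQuot {m} m k))
    up : ∀ y → Generic G y → lev y ≡ 1 → origin ⋖ y
    up y g h with descend G g h
    ... | z , gz , i , j , c = i , j , cover-respˡ
      (λ k l → sym (level≡0⇒central G {z} (ℕP.suc-injective (trans (sym (level-cover c)) h)) k l)) c

  search-terminates : ∃ λ L → BFSResult G L
  search-terminates = exhaust (suc (m ℕ.* m)) [ origin ] _ initial-layer ℕP.≤-refl

  -- Holds along every run, in whatever order the visits are made. In a final state nothing is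
  -- current or queued, so `explored` says that the set of labelled regions is closed under
  -- bordering.
  record Sound (s : BFSState m) : Set where
    open BFSState s
    field
      entries  : ∀ {e} → e ∈ labels → Generic G (proj₁ e) × proj₂ e ≗D ψ (τ G (proj₁ e))
      explored : ∀ {e} → e ∈ labels → current ≡ just (proj₁ e) ⊎ proj₁ e ∈ queue ⊎
                   (∀ y → Generic G y → Bordering G (proj₁ e) y → Labelled G labels y)
      central  : Labelled G labels origin

  sound-step : ∀ {s t} → BFSStep G s t → Sound s → Sound t
  sound-step (pop r q L) inv = record { entries = entries ; explored = explored′ ; central = central }
    where
    open Sound inv
    explored′ : ∀ {e} → e ∈ L → just r ≡ just (proj₁ e) ⊎ proj₁ e ∈ q ⊎ _
    explored′ p with explored p
    ... | inj₂ (inj₁ (here refl)) = inj₁ refl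
    ... | inj₂ (inj₁ (there e∈))  = inj₂ (inj₁ e∈)
    ... | inj₂ (inj₂ done)        = inj₂ (inj₂ done)
  sound-step (finish r q L closed) inv = record { entries = entries ; explored = explored′ ; central = central }
    where
    open Sound inv
    explored′ : ∀ {e} → e ∈ L → nothing ≡ just (proj₁ e) ⊎ proj₁ e ∈ q ⊎ _
    explored′ p with explored p
    ... | inj₁ refl = inj₂ (inj₂ closed)
    ... | inj₂ rest = inj₂ rest
  sound-step (visit r q L d y i j lab g b fresh e bl ab) inv =
    record { entries = entries′ ; explored = explored′ ; central = AnyP.++⁺ˡ central }
    where
    open Sound inv
    c : Cover (τ G r) (τ G y) i j
    c = bordering⇒cover-at G {r} {y} b (τ-false G r (ℚP.<-asym (proj₂ bl))) (τ-true G y e ab)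
    d≗ : d ≗D ψ (τ G r)
    -- The label of `r` may be stored with another point of its region; `ψ ∘ τ` does not distinguish
    -- them.
    d≗ v with find lab
    ... | e′ , e∈ , s , refl = trans (proj₂ (entries e∈) v) (ψ-cong (sameRegion⇒≗O G s) v)
    L′ = L ++ [ (y , addV d j) ]
    entries′ : ∀ {e} → e ∈ L′ → Generic G (proj₁ e) × proj₂ e ≗D ψ (τ G (proj₁ e))
    entries′ p with ∈-++⁻ L p
    ... | inj₁ p′          = entries p′
    ... | inj₂ (here refl) = g , λ v → trans (cong (ℤ._+ _) (d≗ v)) (sym (ψ-cover c v))
    explored′ : ∀ {e} → e ∈ L′ → just r ≡ just (proj₁ e) ⊎ proj₁ e ∈ q ++ [ y ] ⊎
                   (∀ z → Generic G z → Bordering G (proj₁ e) z → Labelled G L′ z)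
    explored′ p with ∈-++⁻ L p
    ... | inj₂ (here refl) = inj₂ (inj₁ (∈-++⁺ʳ q (here refl)))
    ... | inj₁ p′ with explored p′
    ...   | inj₁ cur          = inj₁ cur
    ...   | inj₂ (inj₁ e∈)    = inj₂ (inj₁ (∈-++⁺ˡ e∈))
    ...   | inj₂ (inj₂ done)  = inj₂ (inj₂ (λ z gz bz → AnyP.++⁺ˡ (done z gz bz)))

  sound-star : ∀ {s t} → Star (BFSStep G) s t → Sound s → Sound t
  sound-star stay     inv = inv
  sound-star (st ◅ p) inv = sound-star p (sound-step st inv)

  module _ {L : Labelling m} (result : BFSResult G L) where

    private
      sound : Sound ⟨ nothing , [] , L ⟩
      sound = sound-star result record
        { entries  = λ { (here refl) → origin-generic G , ψ-τ-origin G }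
        ; explored = λ { (here refl) → inj₂ (inj₁ (here refl)) }
        ; central  = here (sameRegion-refl G)
        }
      open Sound sound

    -- Induction on the number of arrows: the region one arrow below is labelled and no longer
    -- queued, so all its neighbours are labelled.
    all-labelled : ∀ n x → Generic G x → lev x ≡ n → Labelled G L x
    all-labelled zero    x g h = labelled-resp G L (≗O⇒sameRegion G (level≡0⇒central G {x} h)) central
    all-labelled (suc n) x g h with descend G g h
    ... | z , gz , i , j , c
      with find (all-labelled n z gz (ℕP.suc-injective (trans (sym (level-cover c)) h)))
    ...   | e , e∈ , s with explored e∈
    ...     | inj₂ (inj₂ done) = done x g
      (cover⇒bordering G (cover-respˡ (λ k l → sym (sameRegion⇒≗O G s k l)) c))

    label-unique : ∀ {x d} → HasLabel G L x d → d ≗D ψ (τ G x)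
    label-unique p v with find p
    ... | e , e∈ , s , e≗d = trans (sym (e≗d v)) (trans (proj₂ (entries e∈) v) (ψ-cong (sameRegion⇒≗O G s) v))

    label-ψτ : ∀ {x d} → Generic G x → ψ (τ G x) ≗D d → HasLabel G L x d
    label-ψτ {x} g h with find (all-labelled _ x g refl)
    ... | e , e∈ , s = lose e∈ (s , λ v → trans (proj₂ (entries e∈) v)
                                        (trans (ψ-cong (sameRegion⇒≗O G s) v) (h v)))

    isLabel : ∀ x → Generic G x → IsLabel G L x (ψ (τ G x))
    isLabel x g = label-ψτ g (λ _ → refl) , λ d p → label-unique p

-- The burning process

∨-true : ∀ {a b} → a ∨ b ≡ true → a ≡ true ⊎ b ≡ true
∨-true {true}  _ = inj₁ refl
∨-true {false} h = inj₂ h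

true-∨ˡ : ∀ {a b} → a ≡ true → a ∨ b ≡ true
true-∨ˡ refl = refl

true-∨ʳ : ∀ {a b} → b ≡ true → a ∨ b ≡ true
true-∨ʳ {true}  _ = refl
true-∨ʳ {false} h = h

∨-false : ∀ {a b} → a ∨ b ≡ false → a ≡ false × b ≡ false
∨-false {false} h = refl , h

not-true : ∀ {a} → not a ≡ true → a ≡ false
not-true {false} _ = refl

true-not : ∀ {a} → a ≡ false → not a ≡ true
true-not refl = refl

==-refl : ∀ {m} (v : Fin m) → (v == v) ≡ true
==-refl v = dec-true (v ≟ v) refl

==-true : ∀ {m} {u v : Fin m} → (u == v) ≡ true → u ≡ v
==-true {u = u} {v} = does-true (u ≟ v)

==-false : ∀ {m} {u v : Fin m} → (u == v) ≡ false → u ≢ v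
==-false {u = u} h refl = true≢false (==-refl u) h

module _ {A : Set} (p : A → Bool) where

  ∈-filterᵇ⁺ : ∀ {x xs} → x ∈ xs → p x ≡ true → x ∈ filterᵇ p xs
  ∈-filterᵇ⁺ x∈ h = ∈-filter⁺ (T? ∘ p) x∈ (Equivalence.from T-≡ h)

  ∈-filterᵇ⁻ : ∀ {x xs} → x ∈ filterᵇ p xs → p x ≡ true
  ∈-filterᵇ⁻ {xs = xs} x∈ = Equivalence.to T-≡ (proj₂ (∈-filter⁻ (T? ∘ p) {xs = xs} x∈))

∈-order : ∀ {m} (σ : Permutation′ m) v → v ∈ order σ
∈-order σ v = subst (_∈ order σ) (inverseʳ σ) (∈-map⁺ (σ ⟨$⟩ʳ_) (∈-allFin (σ ⟨$⟩ˡ v)))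

order-unique : ∀ {m} (σ : Permutation′ m) → Unique (order σ)
order-unique {m} σ = UniqueP.map⁺
  (λ h → trans (sym (inverseˡ σ)) (trans (cong (σ ⟨$⟩ˡ_) h) (inverseˡ σ))) (UniqueP.allFin⁺ m)

allPairs-map : ∀ {A : Set} {R S : A → A → Set} {l : List A} →
  (∀ {u v} → u ∈ l → v ∈ l → R u v → S u v) → AllPairs R l → AllPairs S l
allPairs-map h []       = []
allPairs-map h (p ∷ ps) = All.tabulate (λ v∈ → h (here refl) (there v∈) (All.lookup p v∈)) ∷
  allPairs-map (λ u∈ v∈ → h (there u∈) (there v∈)) ps

record Placed {m} (x : Point m) (lo hi : ℚ) (l : List (Fin m)) : Set where
  field
    x′     : Point m
    off    : ∀ {v} → v ∉ l → x′ v ≡ x v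
    above  : ∀ {v} → v ∈ l → lo ℚ.< x′ v
    below  : ∀ {v} → v ∈ l → x′ v ℚ.< hi
    sorted : AllPairs (λ u v → x′ u ℚ.< x′ v) l

-- Each vertex takes a point of the current interval and the later ones go above it. As the list has
-- no repetitions, a height once given is not overwritten.
place : ∀ {m} (x : Point m) {lo hi} → lo ℚ.< hi → ∀ l → Unique l → Placed x lo hi l
place x lo<hi []      _        = record
  { x′ = x ; off = λ _ → refl ; above = λ () ; below = λ () ; sorted = [] }
place {m} x {lo} {hi} lo<hi (w ∷ l) (w∉ ∷ u) = go (ℚP.<-dense lo<hi)
  where
  go : (∃ λ t → lo ℚ.< t × t ℚ.< hi) → Placed x lo hi (w ∷ l)
  go (t , lo<t , t<hi) = record
    { x′     = x′
    ; off    = λ v∉ → trans (off (v∉ ∘ there)) (x₀-off (v∉ ∘ here))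
    ; above  = λ { (here refl) → subst (lo ℚ.<_) (sym x′w) lo<t ; (there v∈) → ℚP.<-trans lo<t (above v∈) }
    ; below  = λ { (here refl) → subst (ℚ._< hi) (sym x′w) t<hi ; (there v∈) → below v∈ }
    ; sorted = All.tabulate (λ v∈ → subst (ℚ._< x′ _) (sym x′w) (above v∈)) ∷ sorted
    }
    where
    x₀ : Point m
    x₀ v = if v == w then t else x v
    x₀-off : ∀ {v} → v ≢ w → x₀ v ≡ x v
    x₀-off {v} v≢w rewrite dec-false (v ≟ w) v≢w = refl
    open Placed (place x₀ t<hi l u)
    x′w : x′ w ≡ t
    x′w = trans (off (λ w∈ → All.lookup w∉ w∈ refl)) (cong (λ b → if b then t else x w) (==-refl w))

-- `K v` is `c v + 1` as a natural number. It is the threshold of `v`: the initial load is one plus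
-- `c v` short of `degK`, and every fired neighbour adds one chip.
module Burning {m} (G : Graph m) (σ : Permutation′ m) (c : Div m) (K : Fin m → ℕ)
               (c+1≡K : ∀ v → c v ℤ.+ + 1 ≡ + K v) where

  N : (Fin m → Bool) → Fin m → ℕ
  N f v = count (λ u → f u ∧ E G u v)

  HasChips : (Fin m → ℤ) → ℕ → Fin m → Set
  HasChips b n v = b v ≡ ((+ degK G v ℤ.- + 1) ℤ.- c v) ℤ.+ + n

  private
    surplus : ∀ d n c → (((d ℤ.- + 1) ℤ.- c) ℤ.+ n) ℤ.- d ≡ n ℤ.- (c ℤ.+ + 1)
    surplus = ℤSolver.solve-∀

    surplus′ : ∀ {b n} v → HasChips b n v → b v ℤ.- + degK G v ≡ + n ℤ.- + K v
    surplus′ {n = n} v h = trans (cong (ℤ._- + degK G v) h)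
      (trans (surplus (+ degK G v) (+ n) (c v)) (cong (λ k → + n ℤ.- k) (c+1≡K v)))

  unstable⇒≥ : ∀ {b n v} → HasChips b n v → unstable G b v ≡ true → K v ℕ.≤ n
  unstable⇒≥ {b} {n} {v} h t = ℤP.drop‿+≤+ (ℤP.0≤i-j⇒j≤i (subst (+ 0 ℤ.≤_) (surplus′ {b} v h)
    (ℤP.i≤j⇒0≤j-i (ℤP.≤ᵇ⇒≤ {+ degK G v} {b v} (Equivalence.from T-≡ t)))))

  ≥⇒unstable : ∀ {b n v} → HasChips b n v → K v ℕ.≤ n → unstable G b v ≡ true
  ≥⇒unstable {b} {n} {v} h le = Equivalence.to T-≡ (ℤP.≤⇒≤ᵇ {+ degK G v} {b v} (ℤP.0≤i-j⇒j≤i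
    (subst (+ 0 ℤ.≤_) (sym (surplus′ {b} v h)) (ℤP.i≤j⇒0≤j-i (ℤ.+≤+ le)))))

  -- Firing takes chips away and may leave a vertex stable, so having entered the queue is expressed
  -- by fired or unstable.
  Seen : (Fin m → ℤ) → (Fin m → Bool) → Fin m → Set
  Seen b f v = f v ≡ true ⊎ unstable G b v ≡ true

  Waiting : (Fin m → ℤ) → (Fin m → Bool) → Fin m → Set
  Waiting b f v = f v ≡ false × unstable G b v ≡ false

  seen-or-waiting : ∀ b f v → Seen b f v ⊎ Waiting b f v
  seen-or-waiting b f v with bool-cases (f v) | bool-cases (unstable G b v)
  ... | inj₁ t | _      = inj₁ (inj₁ t)
  ... | inj₂ _ | inj₁ t = inj₁ (inj₂ t)
  ... | inj₂ p | inj₂ q = inj₂ (p , q)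

  seen-waiting-⊥ : ∀ b f {v} → Seen b f v → ¬ Waiting b f v
  seen-waiting-⊥ b f (inj₁ t) (p , _) = true≢false t p
  seen-waiting-⊥ b f (inj₂ t) (_ , q) = true≢false t q

  -- x gives a height to every vertex that has entered the queue, in such a way that the orientation
  -- built so far is the one read off from the heights.
  record Invariant (s : EState m) (x : Point m) : Set where
    open EState s renaming (chips to b; fired to f; ori to O; blank to B)
    field
      chips≡    : ∀ {v} → f v ≡ false → HasChips b (N f v) v
      -- The head of an arrow may still wait for its height; the comparison is owed only once the
      -- head is seen.
      ori⇒      : ∀ {u v} → O u v ≡ true → Edge G u v × f u ≡ true × (Seen b f v → Above x u v)
      ⇒ori      : ∀ {u v} → Edge G u v → f u ≡ true → Waiting b f v ⊎ Above x u v → O u v ≡ true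
      marked    : ∀ {u v} → f u ≡ true ⊎ f v ≡ true → Edge G u v → O u v ∨ (O v u ∨ B u v) ≡ true
      blank⇒    : ∀ {u v} → B u v ≡ true → f u ≡ true ⊎ f v ≡ true
      generic   : ∀ {u v} → Seen b f u → Seen b f v → x u ℚ.+ 1ℚ ≢ x v
      queue⇒    : ∀ {v} → v ∈ q → f v ≡ false × unstable G b v ≡ true
      ⇒queue    : ∀ {v} → f v ≡ false → unstable G b v ≡ true → v ∈ q
      sorted    : AllPairs (λ u v → x u ℚ.< x v) q
      close     : ∀ {u v} → u ∈ q → v ∈ q → x v ℚ.< x u ℚ.+ 1ℚ
      behind    : ∀ {u v} → f u ≡ true → v ∈ q → x u ℚ.< x v
      indeg≡    : ∀ {v} → Seen b f v → indeg O v ≡ K v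

  -- One firing preserves the invariant.

  module Firing (b : Fin m → ℤ) (f : Fin m → Bool) (O : POr m) (B : Fin m → Fin m → Bool)
                (w : Fin m) (rest : List (Fin m)) (x : Point m)
                (inv : Invariant (est b f O B (w ∷ rest)) x) where

    open Invariant inv

    s′ : EState m
    s′ = etaStep G σ (est b f O B (w ∷ rest))
    open EState s′ renaming (chips to b′; fired to f′; ori to O′; blank to B′; q to q′)

    isNew : Fin m → Bool
    isNew v = not (f′ v) ∧ unstable G b′ v ∧ not (unstable G b v)

    new : List (Fin m)
    new = filterᵇ isNew (order σ)

    free : Fin m → Bool
    free v = E G w v ∧ not (O w v ∨ O v w ∨ B w v)

    fw : f w ≡ false
    fw = proj₁ (queue⇒ (here refl))

    uw : unstable G b w ≡ true
    uw = proj₂ (queue⇒ (here refl))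

    f′-cases : ∀ {v} → f′ v ≡ true → f v ≡ true ⊎ v ≡ w
    f′-cases h with ∨-true h
    ... | inj₁ t = inj₁ t
    ... | inj₂ t = inj₂ (==-true t)

    f⇒f′ : ∀ {v} → f v ≡ true → f′ v ≡ true
    f⇒f′ = true-∨ˡ

    f′w : f′ w ≡ true
    f′w = true-∨ʳ (==-refl w)

    f′-false : ∀ {v} → f′ v ≡ false → f v ≡ false × v ≢ w
    f′-false h = proj₁ (∨-false h) , ==-false (proj₂ (∨-false h))

    false-f′ : ∀ {v} → f v ≡ false → v ≢ w → f′ v ≡ false
    false-f′ {v} h v≢w rewrite h = dec-false (v ≟ w) v≢w

    f′-off : ∀ {v} → v ≢ w → f v ≡ f′ v
    f′-off v≢w = bool-ext f⇒f′ (λ h → back (f′-cases h))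
      where
      back : f _ ≡ true ⊎ _ → f _ ≡ true
      back (inj₁ t) = t
      back (inj₂ p) = ⊥-elim (v≢w p)

    N′-edge : ∀ {v} → Edge G w v → N f′ v ≡ suc (N f v)
    N′-edge {v} e = count-flip w (cong (_∧ E G w v) fw) (true-∧ f′w e)
      (λ u u≢w → cong (_∧ E G u v) (f′-off u≢w))

    N′-nonedge : ∀ {v} → E G w v ≡ false → N f′ v ≡ N f v
    N′-nonedge {v} ¬e = count-cong λ u → sym (agree u (u ≟ w))
      where
      agree : ∀ u → Dec (u ≡ w) → f u ∧ E G u v ≡ f′ u ∧ E G u v
      agree u (no u≢w)   = cong (_∧ E G u v) (f′-off u≢w)
      agree u (yes refl) = trans (cong (f w ∧_) ¬e) (trans (∧-zeroʳ (f w))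
        (sym (trans (cong (f′ w ∧_) ¬e) (∧-zeroʳ (f′ w)))))

    N≤N′ : ∀ v → N f v ℕ.≤ N f′ v
    N≤N′ v = count-mono λ u h → true-∧ (f⇒f′ (proj₁ (∧-true h))) (proj₂ (∧-true {f u} h))

    chips≡′ : ∀ {v} → f′ v ≡ false → HasChips b′ (N f′ v) v
    chips≡′ {v} h with f′-false h | bool-cases (E G w v)
    ... | fv , v≢w | inj₁ e rewrite dec-false (v ≟ w) v≢w | N′-edge e | e =
      trans (cong (ℤ._+ + 1) (chips≡ fv)) (assoc ((+ degK G v ℤ.- + 1) ℤ.- c v) (+ N f v))
      where
      assoc : ∀ a n → (a ℤ.+ n) ℤ.+ + 1 ≡ a ℤ.+ (+ 1 ℤ.+ n)
      assoc = ℤSolver.solve-∀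
    ... | fv , v≢w | inj₂ ¬e rewrite dec-false (v ≟ w) v≢w | N′-nonedge ¬e | ¬e = chips≡ fv

    stays-unstable : ∀ {v} → f′ v ≡ false → unstable G b v ≡ true → unstable G b′ v ≡ true
    stays-unstable {v} h t = ≥⇒unstable {b′} (chips≡′ h)
      (ℕP.≤-trans (unstable⇒≥ {b} (chips≡ (proj₁ (f′-false h))) t) (N≤N′ v))

    stays-seen : ∀ {v} → Seen b f v → Seen b′ f′ v
    stays-seen (inj₁ t) = inj₁ (f⇒f′ t)
    stays-seen {v} (inj₂ t) with bool-cases (f′ v)
    ... | inj₁ p = inj₁ p
    ... | inj₂ p = inj₂ (stays-unstable p t)

    new⇒ : ∀ {v} → v ∈ new → f′ v ≡ false × unstable G b′ v ≡ true × unstable G b v ≡ false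
    new⇒ {v} v∈ with ∧-true {not (f′ v)} (∈-filterᵇ⁻ isNew {xs = order σ} v∈)
    ... | p , r with ∧-true {unstable G b′ v} r
    ...   | s , t = not-true p , s , not-true t

    ⇒new : ∀ {v} → f′ v ≡ false → unstable G b′ v ≡ true → unstable G b v ≡ false → v ∈ new
    ⇒new {v} p s t = ∈-filterᵇ⁺ isNew (∈-order σ v)
      (true-∧ (true-not p) (true-∧ s (true-not t)))

    new-waiting : ∀ {v} → v ∈ new → Waiting b f v
    new-waiting v∈ = proj₁ (f′-false (proj₁ (new⇒ v∈))) , proj₂ (proj₂ (new⇒ v∈))

    seen′-cases : ∀ {v} → Seen b′ f′ v → Seen b f v ⊎ v ∈ new
    seen′-cases {v} s with seen-or-waiting b f v
    ... | inj₁ p = inj₁ p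
    ... | inj₂ (fv , uv) = inj₂ (from s)
      where
      v≢w : v ≢ w
      v≢w refl = true≢false uw uv
      from : Seen b′ f′ v → v ∈ new
      from (inj₁ t) = ⊥-elim (true≢false t (false-f′ fv v≢w))
      from (inj₂ t) = ⇒new (false-f′ fv v≢w) t uv

    -- One firing raises the number of fired neighbours by at most one, so a vertex that crosses its
    -- threshold meets it with equality.
    new-count : ∀ {v} → v ∈ new → N f′ v ≡ K v
    new-count {v} v∈ with new⇒ v∈ | bool-cases (E G w v)
    ... | p , s , t | inj₁ e  = ℕP.≤-antisym
      (subst (ℕ._≤ K v) (sym (N′-edge e)) (ℕP.≰⇒> (λ le → true≢false (≥⇒unstable {b} (chips≡ (proj₁ (f′-false p))) le) t)))
      (unstable⇒≥ {b′} (chips≡′ p) s)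
    ... | p , s , t | inj₂ ¬e = ⊥-elim (true≢false
      (≥⇒unstable {b} (chips≡ (proj₁ (f′-false p)))
        (subst (K v ℕ.≤_) (N′-nonedge ¬e) (unstable⇒≥ {b′} (chips≡′ p) s))) t)

    seen-below : ∀ {v} → Seen b f v → x v ℚ.< x w ℚ.+ 1ℚ
    seen-below {v} s with bool-cases (f v)
    ... | inj₁ t = ℚP.<-trans (behind t (here refl)) (p<p+1 (x w))
    ... | inj₂ fv with s
    ...   | inj₁ t = ⊥-elim (true≢false t fv)
    ...   | inj₂ t = close (here refl) (⇒queue fv t)

    ceiling : ∃ λ hi → x w ℚ.+ 1ℚ ℚ.< hi × hi ℚ.≤ (x w ℚ.+ 1ℚ) ℚ.+ 1ℚ × (∀ {u} → u ∈ rest → hi ℚ.≤ x u ℚ.+ 1ℚ)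
    ceiling = go rest sorted (λ p → close (here refl) (there p))
      where
      go : ∀ l → AllPairs (λ u v → x u ℚ.< x v) (w ∷ l) → (∀ {v} → v ∈ l → x v ℚ.< x w ℚ.+ 1ℚ) →
        ∃ λ hi → x w ℚ.+ 1ℚ ℚ.< hi × hi ℚ.≤ (x w ℚ.+ 1ℚ) ℚ.+ 1ℚ × (∀ {u} → u ∈ l → hi ℚ.≤ x u ℚ.+ 1ℚ)
      -- With nothing else queued, `x w` + 2 still keeps the new vertices within 1 of each other.
      go []      _                     _ = (x w ℚ.+ 1ℚ) ℚ.+ 1ℚ , p<p+1 _ , ℚP.≤-refl , λ ()
      go (v ∷ l) ((w<v ∷ _) ∷ v< ∷ _) h = x v ℚ.+ 1ℚ , +1-mono-< w<v , ℚP.<⇒≤ (+1-mono-< (h (here refl))) ,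
        λ { (here refl) → ℚP.≤-refl ; (there u∈) → ℚP.<⇒≤ (+1-mono-< (All.lookup v< u∈)) }

    hi = proj₁ ceiling
    lo<hi : x w ℚ.+ 1ℚ ℚ.< hi
    lo<hi = proj₁ (proj₂ ceiling)
    hi≤ : hi ℚ.≤ (x w ℚ.+ 1ℚ) ℚ.+ 1ℚ
    hi≤ = proj₁ (proj₂ (proj₂ ceiling))
    hi≤rest : ∀ {u} → u ∈ rest → hi ℚ.≤ x u ℚ.+ 1ℚ
    hi≤rest = proj₂ (proj₂ (proj₂ ceiling))

    placement : Placed x (x w ℚ.+ 1ℚ) hi new
    placement = place x lo<hi new (UniqueP.filter⁺ (T? ∘ isNew) (order-unique σ))

    open Placed placement using (x′) renaming (off to x′-off; above to x′-above; below to x′-below; sorted to x′-sorted)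

    x′-old : ∀ {v} → Seen b f v → x′ v ≡ x v
    x′-old s = x′-off (λ v∈ → seen-waiting-⊥ b f s (new-waiting v∈))

    w-seen : Seen b f w
    w-seen = inj₂ uw

    rest-seen : ∀ {v} → v ∈ rest → Seen b f v
    rest-seen v∈ = inj₂ (proj₂ (queue⇒ (there v∈)))

    w<rest : ∀ {v} → v ∈ rest → x w ℚ.< x v
    w<rest v∈ with sorted
    ... | w< ∷ _ = All.lookup w< v∈

    fired≤w : ∀ {u} → f′ u ≡ true → x′ u ℚ.≤ x w
    fired≤w h with f′-cases h
    ... | inj₁ t    = subst (ℚ._≤ x w) (sym (x′-old (inj₁ t))) (ℚP.<⇒≤ (behind t (here refl)))
    ... | inj₂ refl = ℚP.≤-reflexive (x′-old w-seen)

    above-new : ∀ {u v} → f′ u ≡ true → v ∈ new → Above x′ u v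
    above-new h v∈ = ℚP.≤-<-trans (ℚP.+-monoˡ-≤ 1ℚ (fired≤w h)) (x′-above v∈)

    -- An edge is oriented or marked blank at the first firing of one of its ends, so the edges at
    -- `w` that are still free lead to unfired vertices.
    free⇒ : ∀ {v} → free v ≡ true → Edge G w v × f v ≡ false
    free⇒ {v} h with ∧-true {E G w v} h
    ... | e , unmarked = e , ≢true⇒≡false λ t → true≢false (marked (inj₂ t) e) (not-true unmarked)

    ⇒free : ∀ {v} → Edge G w v → f v ≡ false → free v ≡ true
    ⇒free {v} e fv = true-∧ e (true-not (≢true⇒≡false unmarked))
      where
      unmarked : O w v ∨ O v w ∨ B w v ≢ true
      unmarked h with ∨-true {O w v} h
      ... | inj₁ t = true≢false (proj₁ (proj₂ (ori⇒ t))) fw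
      ... | inj₂ h′ with ∨-true {O v w} h′
      ...   | inj₁ t = true≢false (proj₁ (proj₂ (ori⇒ t))) fv
      ...   | inj₂ t with blank⇒ t
      ...     | inj₁ p = true≢false p fw
      ...     | inj₂ p = true≢false p fv

    O′-cases : ∀ {u v} → O′ u v ≡ true → O u v ≡ true ⊎ (u ≡ w × Edge G w v × Waiting b f v)
    O′-cases {u} {v} h with ∨-true {O u v} h
    ... | inj₁ t = inj₁ t
    ... | inj₂ h₁ with ∧-true {u == w} h₁
    ...   | u≡w , h₂ with ∧-true {free v} h₂
    ...     | fr , st = inj₂ (==-true u≡w , proj₁ (free⇒ fr) , proj₂ (free⇒ fr) , not-true st)

    O⇒O′ : ∀ {u v} → O u v ≡ true → O′ u v ≡ true
    O⇒O′ = true-∨ˡ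

    new-arrow : ∀ {v} → Edge G w v → Waiting b f v → O′ w v ≡ true
    new-arrow {v} e (fv , uv) = true-∨ʳ {O w v}
      (true-∧ (==-refl w) (true-∧ (⇒free e fv) (true-not uv)))

    ori⇒′ : ∀ {u v} → O′ u v ≡ true → Edge G u v × f′ u ≡ true × (Seen b′ f′ v → Above x′ u v)
    ori⇒′ {u} {v} h with O′-cases {u} {v} h
    ... | inj₁ t = proj₁ (ori⇒ t) , f⇒f′ fu , above
      where
      fu = proj₁ (proj₂ (ori⇒ t))
      above : Seen b′ f′ v → Above x′ u v
      above s with seen′-cases s
      ... | inj₁ old = subst₂ (λ p r → p ℚ.+ 1ℚ ℚ.< r) (sym (x′-old (inj₁ fu))) (sym (x′-old old))
                         (proj₂ (proj₂ (ori⇒ t)) old)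
      ... | inj₂ v∈  = above-new (f⇒f′ fu) v∈
    ... | inj₂ (refl , e , wait) = e , f′w , above
      where
      above : Seen b′ f′ v → Above x′ u v
      above s with seen′-cases s
      ... | inj₁ old = ⊥-elim (seen-waiting-⊥ b f old wait)
      ... | inj₂ v∈  = above-new f′w v∈

    ¬above-w : ∀ {v} → Seen b f v → ¬ Above x w v
    ¬above-w s p = ℚP.<-asym p (seen-below s)

    ⇒ori′ : ∀ {u v} → Edge G u v → f′ u ≡ true → Waiting b′ f′ v ⊎ Above x′ u v → O′ u v ≡ true
    ⇒ori′ {u} {v} e fu h with seen-or-waiting b f v | f′-cases fu
    ... | inj₂ wait | inj₁ t    = O⇒O′ (⇒ori e t (inj₁ wait))
    ... | inj₂ wait | inj₂ refl = new-arrow e wait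
    ... | inj₁ s    | old = from h old
      where
      above-old : Seen b f u → Above x′ u v → Above x u v
      above-old t = subst₂ (λ p r → p ℚ.+ 1ℚ ℚ.< r) (x′-old t) (x′-old s)
      from : Waiting b′ f′ v ⊎ Above x′ u v → f u ≡ true ⊎ u ≡ w → O′ u v ≡ true
      from (inj₁ wait) _           = ⊥-elim (seen-waiting-⊥ b′ f′ (stays-seen s) wait)
      from (inj₂ p)    (inj₁ t)    = O⇒O′ (⇒ori e t (inj₂ (above-old (inj₁ t) p)))
      from (inj₂ p)    (inj₂ refl) = ⊥-elim (¬above-w s (above-old w-seen p))

    marked′ : ∀ {u v} → f′ u ≡ true ⊎ f′ v ≡ true → Edge G u v → O′ u v ∨ (O′ v u ∨ B′ u v) ≡ true
    marked′ {u} {v} h e = cases (bool-cases (f u)) (bool-cases (f v)) h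
      where
      old : f u ≡ true ⊎ f v ≡ true → O′ u v ∨ (O′ v u ∨ B′ u v) ≡ true
      old t with ∨-true {O u v} (marked t e)
      ... | inj₁ p = true-∨ˡ (O⇒O′ p)
      ... | inj₂ p with ∨-true {O v u} p
      ...   | inj₁ r = true-∨ʳ {O′ u v} (true-∨ˡ (O⇒O′ r))
      ...   | inj₂ r = true-∨ʳ {O′ u v} (true-∨ʳ {O′ v u} (true-∨ˡ r))
      fromˡ : u ≡ w → f v ≡ false → O′ u v ∨ (O′ v u ∨ B′ u v) ≡ true
      fromˡ refl fv with bool-cases (unstable G b v)
      ... | inj₂ uv = true-∨ˡ (new-arrow e (fv , uv))
      ... | inj₁ uv = true-∨ʳ {O′ w v} (true-∨ʳ {O′ v w} (true-∨ʳ {B w v}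
              (true-∨ˡ (true-∧ (==-refl w) (true-∧ (⇒free e fv) uv)))))
      fromʳ : v ≡ w → f u ≡ false → O′ u v ∨ (O′ v u ∨ B′ u v) ≡ true
      fromʳ refl fu with bool-cases (unstable G b u)
      ... | inj₂ uu = true-∨ʳ {O′ u w} (true-∨ˡ (new-arrow (trans (E-sym G w u) e) (fu , uu)))
      ... | inj₁ uu = true-∨ʳ {O′ u w} (true-∨ʳ {O′ w u} (true-∨ʳ {B u w} (true-∨ʳ
              {(u == w) ∧ (free w ∧ unstable G b w)}
              (true-∧ (==-refl w) (true-∧ (⇒free (trans (E-sym G w u) e) fu) uu)))))
      cases : f u ≡ true ⊎ f u ≡ false → f v ≡ true ⊎ f v ≡ false → f′ u ≡ true ⊎ f′ v ≡ true →
        O′ u v ∨ (O′ v u ∨ B′ u v) ≡ true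
      cases (inj₁ fu) _         _ = old (inj₁ fu)
      cases (inj₂ _)  (inj₁ fv) _ = old (inj₂ fv)
      cases (inj₂ fu) (inj₂ fv) (inj₁ t) with f′-cases t
      ... | inj₁ fu′ = old (inj₁ fu′)
      ... | inj₂ p   = fromˡ p fv
      cases (inj₂ fu) (inj₂ fv) (inj₂ t) with f′-cases t
      ... | inj₁ fv′ = old (inj₂ fv′)
      ... | inj₂ p   = fromʳ p fu

    blank⇒′ : ∀ {u v} → B′ u v ≡ true → f′ u ≡ true ⊎ f′ v ≡ true
    blank⇒′ {u} {v} h with ∨-true {B u v} h
    ... | inj₁ t with blank⇒ t
    ...   | inj₁ p = inj₁ (f⇒f′ p)
    ...   | inj₂ p = inj₂ (f⇒f′ p)
    blank⇒′ {u} {v} h | inj₂ h₁ with ∨-true {(u == w) ∧ (free v ∧ unstable G b v)} h₁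
    ... | inj₁ p = inj₁ (true-∨ʳ (proj₁ (∧-true {u == w} p)))
    ... | inj₂ p = inj₂ (true-∨ʳ (proj₁ (∧-true {v == w} p)))

    unfired-rest : ∀ {u} → Seen b f u → f′ u ≡ false → u ∈ rest
    unfired-rest (inj₁ t) fu = ⊥-elim (true≢false t (proj₁ (f′-false fu)))
    unfired-rest (inj₂ t) fu with ⇒queue (proj₁ (f′-false fu)) t
    ... | here p   = ⊥-elim (proj₂ (f′-false fu) p)
    ... | there u∈ = u∈

    generic′ : ∀ {u v} → Seen b′ f′ u → Seen b′ f′ v → x′ u ℚ.+ 1ℚ ≢ x′ v
    generic′ {u} {v} su sv eq with seen′-cases su | seen′-cases sv
    ... | inj₁ ou | inj₁ ov = generic ou ov
      (trans (cong (ℚ._+ 1ℚ) (sym (x′-old ou))) (trans eq (x′-old ov)))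
    ... | inj₂ u∈ | inj₁ ov = ℚP.<-irrefl (trans (sym (x′-old ov)) (sym eq))
      (ℚP.<-trans (seen-below ov) (ℚP.<-trans (x′-above u∈) (p<p+1 (x′ u))))
    ... | inj₂ u∈ | inj₂ v∈ = ℚP.<-irrefl (sym eq)
      (ℚP.<-trans (ℚP.<-≤-trans (x′-below v∈) hi≤) (+1-mono-< (x′-above u∈)))
    -- A fired `u` lies more than 1 below the new `v`. An unfired one is still queued, and then `hi`
    -- keeps `v` less than 1 above it.
    ... | inj₁ ou | inj₂ v∈ with bool-cases (f′ u)
    ...   | inj₁ t = ℚP.<-irrefl eq (above-new t v∈)
    ...   | inj₂ fu with su
    ...     | inj₁ t = true≢false t fu
    ...     | inj₂ t = ℚP.<-irrefl (trans (sym eq) (cong (ℚ._+ 1ℚ) (x′-old ou)))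
      (ℚP.<-≤-trans (x′-below v∈) (hi≤rest (unfired-rest ou fu)))

    queue⇒′ : ∀ {v} → v ∈ q′ → f′ v ≡ false × unstable G b′ v ≡ true
    queue⇒′ {v} v∈ with ∈-++⁻ rest v∈
    ... | inj₂ p = proj₁ (new⇒ p) , proj₁ (proj₂ (new⇒ p))
    ... | inj₁ p = fv , stays-unstable fv (proj₂ (queue⇒ (there p)))
      where
      fv : f′ v ≡ false
      fv = false-f′ (proj₁ (queue⇒ (there p))) λ { refl → ℚP.<-irrefl refl (w<rest p) }

    ⇒queue′ : ∀ {v} → f′ v ≡ false → unstable G b′ v ≡ true → v ∈ q′
    ⇒queue′ {v} fv uv with bool-cases (unstable G b v)
    ... | inj₂ old = ∈-++⁺ʳ rest (⇒new fv uv old)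
    ... | inj₁ old with ⇒queue (proj₁ (f′-false fv)) old
    ...   | here p   = ⊥-elim (proj₂ (f′-false fv) p)
    ...   | there v∈ = ∈-++⁺ˡ v∈

    rest<new : ∀ {u v} → u ∈ rest → v ∈ new → x′ u ℚ.< x′ v
    rest<new u∈ v∈ = ℚP.<-trans
      (subst (ℚ._< x w ℚ.+ 1ℚ) (sym (x′-old (rest-seen u∈))) (seen-below (rest-seen u∈))) (x′-above v∈)

    sorted′ : AllPairs (λ u v → x′ u ℚ.< x′ v) q′
    sorted′ = AllPairsP.++⁺
      (allPairs-map (λ u∈ v∈ → subst₂ ℚ._<_ (sym (x′-old (rest-seen u∈))) (sym (x′-old (rest-seen v∈))))
        (AllPairs.tail sorted))
      x′-sorted
      (All.tabulate (λ u∈ → All.tabulate (λ v∈ → rest<new u∈ v∈)))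

    close′ : ∀ {u v} → u ∈ q′ → v ∈ q′ → x′ v ℚ.< x′ u ℚ.+ 1ℚ
    close′ {u} {v} u∈ v∈ with ∈-++⁻ rest u∈ | ∈-++⁻ rest v∈
    ... | inj₁ p | inj₁ r = subst₂ (λ s t → s ℚ.< t ℚ.+ 1ℚ) (sym (x′-old (rest-seen r))) (sym (x′-old (rest-seen p)))
                              (close (there p) (there r))
    ... | inj₁ p | inj₂ r = ℚP.<-≤-trans (x′-below r)
                              (subst (λ t → hi ℚ.≤ t ℚ.+ 1ℚ) (sym (x′-old (rest-seen p))) (hi≤rest p))
    ... | inj₂ p | inj₁ r = ℚP.<-trans (rest<new r p) (p<p+1 (x′ u))
    ... | inj₂ p | inj₂ r = ℚP.<-trans (ℚP.<-≤-trans (x′-below r) hi≤) (+1-mono-< (x′-above p))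

    behind′ : ∀ {u v} → f′ u ≡ true → v ∈ q′ → x′ u ℚ.< x′ v
    behind′ fu v∈ with ∈-++⁻ rest v∈
    ... | inj₁ r = ℚP.≤-<-trans (fired≤w fu) (subst (x w ℚ.<_) (sym (x′-old (rest-seen r))) (w<rest r))
    ... | inj₂ r = ℚP.<-trans (p<p+1 _) (above-new fu r)

    -- Arrows are added only into waiting vertices, so the in-degree of a seen vertex is frozen. For
    -- a vertex entering now, every fired neighbour has an arrow into it, and `new-count` gives
    -- their number.
    indeg≡′ : ∀ {v} → Seen b′ f′ v → indeg O′ v ≡ K v
    indeg≡′ {v} s with seen′-cases s
    ... | inj₁ old = trans (count-cong same) (indeg≡ old)
      where
      same : ∀ u → O′ u v ≡ O u v
      same u = bool-ext back O⇒O′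
        where
        back : O′ u v ≡ true → O u v ≡ true
        back h with O′-cases {u} {v} h
        ... | inj₁ t              = t
        ... | inj₂ (_ , _ , wait) = ⊥-elim (seen-waiting-⊥ b f old wait)
    ... | inj₂ v∈ = trans (count-cong same) (new-count v∈)
      where
      same : ∀ u → O′ u v ≡ f′ u ∧ E G u v
      same u = bool-ext
        (λ h → true-∧ (proj₁ (proj₂ (ori⇒′ h))) (proj₁ (ori⇒′ {u} {v} h)))
        (λ h → ⇒ori′ (proj₂ (∧-true {f′ u} h)) (proj₁ (∧-true {f′ u} h))
                 (inj₂ (above-new (proj₁ (∧-true {f′ u} h)) v∈)))

    invariant′ : Invariant s′ x′
    invariant′ = record
      { chips≡ = chips≡′ ; ori⇒ = ori⇒′ ; ⇒ori = ⇒ori′ ; marked = marked′ ; blank⇒ = blank⇒′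
      ; generic = generic′ ; queue⇒ = queue⇒′ ; ⇒queue = ⇒queue′ ; sorted = sorted′
      ; close = close′ ; behind = behind′ ; indeg≡ = indeg≡′ }

    fired-count : count f′ ≡ suc (count f)
    fired-count = count-flip w fw f′w (λ u → f′-off)

  b₀ : Fin m → ℤ
  b₀ v = (+ degK G v ℤ.- + 1) ℤ.- c v

  start : EState m
  start = est b₀ (λ _ → false) (λ _ _ → false) (λ _ _ → false) (filterᵇ (unstable G b₀) (order σ))

  -- The vertices unstable at the start are those with `K v` = 0, in agreement with in-degree 0.
  -- Heights strictly between 0 and 1 make them close to each other.
  initial : ∃ λ x → Invariant start x
  initial = x′ , record
    { chips≡  = λ _ → has-chips
    ; ori⇒    = λ ()
    ; ⇒ori    = λ _ ()
    ; marked  = λ { (inj₁ ()) ; (inj₂ ()) }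
    ; blank⇒  = λ ()
    ; generic = λ { (inj₂ s) (inj₂ t) h → ℚP.<-irrefl (sym h) (near (queued s) (queued t)) }
    ; queue⇒  = λ v∈ → refl , ∈-filterᵇ⁻ (unstable G b₀) {xs = order σ} v∈
    ; ⇒queue  = λ _ → queued
    ; sorted  = sorted
    ; close   = near
    ; behind  = λ ()
    ; indeg≡  = λ { {v} (inj₂ t) → trans (count-false {p = λ u → EState.ori start u v} (λ _ → refl))
                  (sym (ℕP.n≤0⇒n≡0 (subst (K v ℕ.≤_) (no-fired v) (unstable⇒≥ {b₀} has-chips t)))) }
    }
    where
    no-fired : ∀ v → N (λ _ → false) v ≡ 0
    no-fired v = count-false {p = λ u → false ∧ E G u v} (λ _ → refl)
    has-chips : ∀ {v} → HasChips b₀ (N (λ _ → false) v) v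
    has-chips {v} = trans (sym (ℤP.+-identityʳ (b₀ v))) (cong (λ n → b₀ v ℤ.+ + n) (sym (no-fired v)))
    queued : ∀ {v} → unstable G b₀ v ≡ true → v ∈ filterᵇ (unstable G b₀) (order σ)
    queued {v} = ∈-filterᵇ⁺ (unstable G b₀) (∈-order σ v)
    open Placed (place (λ _ → 0ℚ) 0<1 (filterᵇ (unstable G b₀) (order σ))
                   (UniqueP.filter⁺ (T? ∘ unstable G b₀) (order-unique σ)))
    near : ∀ {u v} → u ∈ filterᵇ (unstable G b₀) (order σ) → v ∈ filterᵇ (unstable G b₀) (order σ) →
      x′ v ℚ.< x′ u ℚ.+ 1ℚ
    near {u} {v} u∈ v∈ = ℚP.<-trans (below v∈)
      (subst (ℚ._< x′ u ℚ.+ 1ℚ) (ℚP.+-identityˡ 1ℚ) (+1-mono-< (above u∈)))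

  halted : ∀ k {b f O B} → iter k (etaStep G σ) (est b f O B []) ≡ est b f O B []
  halted zero    = refl
  halted (suc k) = halted k

  Finished : EState m → Set
  Finished s = ∃ λ x → Invariant s x × EState.q s ≡ []

  -- The number of iterations left equals the number of unfired vertices, and a firing lowers both.
  -- Thus the `m` iterations in `η` empty the queue, and idle ones change nothing.
  run : ∀ k s {x} → Invariant s x → count (EState.fired s) ℕ.+ k ≡ m → Finished (iter k (etaStep G σ) s)
  run k       (est b f O B [])         {x} inv h = subst Finished (sym (halted k)) (x , inv , refl)
  run zero    (est b f O B (w ∷ rest))     inv h = ⊥-elim (ℕP.<-irrefl (trans (sym (ℕP.+-identityʳ _)) h)
    (count-<-missing f w (proj₁ (Invariant.queue⇒ inv (here refl)))))
  run (suc k) (est b f O B (w ∷ rest)) {x} inv h =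
    run k s′ invariant′ (trans (cong (ℕ._+ k) fired-count) (trans (sym (ℕP.+-suc _ k)) h))
    where open Firing b f O B w rest x inv

  -- Dhar: when the queue is empty, the unfired vertices could be fired together from c + 1.
  everything-fired : InS G c → ∀ {s x} → Invariant s x → EState.q s ≡ [] → ∀ v → EState.fired s v ≡ true
  everything-fired (_ , stable) {est b f O B .[]} inv refl v with bool-cases (f v)
  ... | inj₁ t  = t
  ... | inj₂ fv = ⊥-elim (stable X (v , true-not fv) legal)
    where
    open Invariant inv
    X : Fin m → Bool
    X u = not (f u)
    not-X : ∀ u → N f u ≡ count (λ t → not (X t) ∧ E G t u)
    not-X u = count-cong λ t → cong (_∧ E G t u) (double (f t))
      where
      double : ∀ a → a ≡ not (not a)
      double true  = refl
      double false = refl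
    legal : ∀ u → + 0 ℤ.≤ (c u ℤ.+ + 1) ℤ.- lapInd G X u
    legal u with bool-cases (f u)
    ... | inj₁ fu = subst (+ 0 ℤ.≤_) (sym (cong₂ ℤ._-_ (c+1≡K u) (lapInd-outside G X (cong not fu))))
      (subst (λ n → + 0 ℤ.≤ + K u ℤ.+ n) (sym (ℤP.neg-involutive (+ count (λ t → X t ∧ E G t u))))
        (ℤ.+≤+ ℕ.z≤n))
    -- An unfired vertex would lose one chip to the sink and one per fired neighbour, `N f u` + 1 in
    -- all. Being stable, it has `N f u` < `K u`.
    ... | inj₂ fu = subst (+ 0 ℤ.≤_) (sym (cong₂ ℤ._-_ (c+1≡K u) (lapInd-inside G X (cong not fu))))
      (ℤP.i≤j⇒0≤j-i (ℤ.+≤+ (subst (ℕ._< K u) (not-X u) (ℕP.≰⇒> λ le →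
        empty (⇒queue fu (≥⇒unstable {b} (chips≡ fu) le))))))
      where
      empty : ¬ (u ∈ [])
      empty ()

  record Realised : Set where
    field
      height      : Point m
      generic     : Generic G height
      orientation : η G σ c ≗O τ G height
      divisor     : ψ (η G σ c) ≗D c

  realised : InS G c → Realised
  realised c∈S = conclude (run m start (proj₂ initial) (cong (ℕ._+ m) (count-false {m} (λ _ → refl))))
    where
    conclude : Finished (iter m (etaStep G σ) start) → Realised
    conclude (x , inv , empty) = record
      { height      = x
      ; generic     = λ i j e → Invariant.generic inv (inj₁ (fired i)) (inj₁ (fired j))
      ; orientation = λ i j → bool-ext
          (λ h → τ-true G x (proj₁ (ori⇒ h)) (proj₂ (proj₂ (ori⇒ h)) (inj₁ (fired j))))
          (λ t → ⇒ori (τ-edge G x t) (fired i) (inj₂ (τ-above G x t)))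
      ; divisor     = λ v → trans (cong (λ k → + k ℤ.- + 1) (indeg≡ (inj₁ (fired v))))
          (trans (cong (ℤ._- + 1) (sym (c+1≡K v))) (cancel (c v)))
      }
      where
      open Invariant inv using (ori⇒; ⇒ori; indeg≡)
      fired = everything-fired c∈S inv empty
      cancel : ∀ a → (a ℤ.+ + 1) ℤ.- + 1 ≡ a
      cancel = ℤSolver.solve-∀

-- Consequences for `η` and for the labelling.

module _ {m} (G : Graph m) (c : Div m) (c∈S : InS G c) where

  private
    K : Fin m → ℕ
    K v = ℤ.∣ c v ℤ.+ + 1 ∣

  η-realised : ∀ σ → Burning.Realised G σ c K (λ v → sym (ℤP.0≤i⇒+∣i∣≡i (proj₁ c∈S v)))
  η-realised σ = Burning.realised G σ c K (λ v → sym (ℤP.0≤i⇒+∣i∣≡i (proj₁ c∈S v))) c∈S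

  module _ (σ : Permutation′ m) where

    open Burning.Realised (η-realised σ)

    ψ-η : ψ (η G σ c) ≗D c
    ψ-η = divisor

    η-partialOrientation : IsPartialOrientation G (η G σ c)
    η-partialOrientation i j h = τ-edge G height above ,
      trans (orientation j i) (τ-false G height (Above-asym height (τ-above G height above)))
      where
      above : τ G height i j ≡ true
      above = trans (sym (orientation i j)) h

    η-InRho : ∃ λ x → InRho G (η G σ c) x
    η-InRho = height , λ i j e →
      (λ t → τ-above G height (trans (sym (orientation i j)) t)) ,
      (λ f f′ → τ-below G height generic (trans (E-sym G j i) e) (trans (sym (orientation j i)) f′) ,
                τ-below G height generic e (trans (sym (orientation i j)) f))

    η-semiorientation : IsSemiorientation G (η G σ c)
    η-semiorientation = InRho⇒semiorientation G (proj₂ η-InRho) η-partialOrientation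

    label-η : ∀ {L} → BFSResult G L → ∀ x → InRho G (η G σ c) x → HasLabel G L x c
    label-η result x r = Search.label-ψτ G result {x} {c} (InRho⇒generic G {η G σ c} {x} η-partialOrientation r)
      (λ v → trans (ψ-cong (λ i j → sym (InRho⇒τ G {η G σ c} {x} η-partialOrientation r i j)) v) (ψ-η v))

  -- Surjectivity follows from the right inverse given by any one ordering of the vertices; the
  -- identity is chosen.
  S-labelled : ∀ {L} → BFSResult G L → ∃ λ x → Generic G x × HasLabel G L x c
  S-labelled result = height , generic , label-η id-permutation result height (proj₂ (η-InRho id-permutation))
    where open Burning.Realised (η-realised id-permutation)

-- On quasi-superstable divisors `ψ` is a left inverse of `η`.
η-injective : ∀ {m} (G : Graph m) σ (c c′ : Div m) → InS G c → InS G c′ → η G σ c ≗O η G σ c′ → c ≗D c′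
η-injective G σ c c′ c∈S c′∈S same v =
  trans (sym (ψ-η G c c∈S σ v)) (trans (ψ-cong same v) (ψ-η G c′ c′∈S σ v))

InS-resp : ∀ {m} (G : Graph m) {c d : Div m} → d ≗D c → InS G c → InS G d
InS-resp G d≗c (nonneg , stable) =
  (λ v → subst (λ n → + 0 ℤ.≤ n ℤ.+ + 1) (sym (d≗c v)) (nonneg v)) ,
  (λ X ne legal → stable X ne (λ v → subst (λ n → + 0 ℤ.≤ n ℤ.+ + 1 ℤ.- lapInd G X v) (d≗c v) (legal v)))

theorem3p13 : (n : ℕ) (G : Graph (suc n)) → Connected G →
    (∃ λ L → BFSResult G L) ×
    (∀ L → BFSResult G L →
    (∀ x → Generic G x → IsLabel G L x (ψ (τ G x))) ×
    (∀ x d → Generic G x → HasLabel G L x d → InS G d) ×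
    (∀ c → InS G c → ∃ λ x → Generic G x × HasLabel G L x c) ×
    (∀ (σ : Permutation′ (suc n)) c → InS G c →
    IsSemiorientation G (η G σ c) ×
    (∃ λ x → InRho G (η G σ c) x) ×
    (∀ x → InRho G (η G σ c) x → HasLabel G L x c))) ×
    (∀ (σ : Permutation′ (suc n)) c c' → InS G c → InS G c' →
    (∀ i j → η G σ c i j ≡ η G σ c' i j) → c ≗D c')
theorem3p13 n G _ =
  search-terminates ,
  (λ L result →
    isLabel result ,
    (λ x d _ h → InS-resp G (label-unique result h) (ψτ∈S G x)) ,
    (λ c c∈S → S-labelled G c c∈S result) ,
    (λ σ c c∈S → η-semiorientation G c c∈S σ , η-InRho G c c∈S σ , label-η G c c∈S σ result)) ,
  η-injective G
  where open Search G
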